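{- For integers $1\le i<r$, \[ C_{i+1,r}=C_{i,r}+\sum_{k=r-i+1}^{r-1}C_{r-i+1,k}\,C_{r-k,r-k}-\sum_{k=i}^{r-1}C_{i,k}\,C_{r-k,r-k}, \] with initial values $C_{1,r}=(-1)^r/(r+1)$ for $r\ge1$.
   Context: Bernoulli numbers $B_n$ are defined by $\sum_{n\ge0}B_n x^n/n! = xe^x/(e^x-1)$. For a finite set $S\subset\mathbb Z_{\ge0}^r$, $C(S)=(-1)^r\sum_{(n_1,\dots,n_r)\in S}\prod_{j}B_{n_j}/n_j!$. For $1\le i\le r$, $C_{i,r}=C(S)$ where $S$ is the set of $(n_1,\dots,n_r)\in\mathbb Z_{\ge0}^r$ with $n_1+\dots+n_r=r$, $n_1+\dots+n_j<j$ for $1\le j<i$, and $n_{j+1}+\dots+n_r\le r-j$ for $i\le j<r$. (These are the coefficients $C^{(1,\dots,1,0,\dots,0)}$ with $i-1$ ones and $r-i$ zeros of the asymptotic expansion of the Euler–Zagier multiple zeta function at the origin.) -}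

module Defs where

open import Data.Integer.Base using (1ℤ; -1ℤ)
import Data.Integer.Base as ℤ
open import Data.List.Base
  using (List; []; _∷_; map; foldr; filter; upTo; applyUpTo; take; drop; cartesianProductWith)
open import Data.List.Membership.Propositional using (_∈_)
open import Data.List.Membership.Propositional.Properties
  using (∈-cartesianProductWith⁺; ∈-filter⁺; ∈-filter⁻; ∈-upTo⁺)
open import Data.List.Relation.Unary.All using ([])
open import Data.List.Relation.Unary.AllPairs using ([]; _∷_)
open import Data.List.Relation.Unary.Any using (here)
open import Data.List.Relation.Unary.Unique.Propositional using (Unique)
import Data.List.Relation.Unary.Unique.Propositional.Properties as Unique
open import Data.Nat.Base using (ℕ; zero; suc; _∸_; _!; _≤_; _<_; s≤s)
import Data.Nat.Base as ℕ
open import Data.Nat.ListAction using (sum)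
import Data.Nat.Properties as ℕ
open import Data.Product.Base using (_×_; _,_; proj₂)
open import Data.Rational.Base using (ℚ; 0ℚ; 1ℚ; _+_; _*_; _-_; -_; _/_; toℚᵘ)
open import Data.Rational.Properties as ℚ using ()
import Data.Rational.Unnormalised.Base as ℚᵘ
import Data.Rational.Unnormalised.Properties as ℚᵘ
open import Data.Vec.Base using (Vec; []; _∷_; toList)
open import Data.Vec.Properties using (∷-injective)
open import Function.Bundles using (_⇔_; mk⇔)
open import Relation.Binary.PropositionalEquality
  using (_≡_; _≗_; refl; sym; trans; cong; cong₂; module ≡-Reasoning)
open import Relation.Nullary.Decidable using (Dec; map′; _×-dec_; _→-dec_)

sumℚ : List ℚ → ℚ
sumℚ = foldr _+_ 0ℚ

productℚ : List ℚ → ℚ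
productℚ = foldr _*_ 1ℚ

-- Both bounds are inclusive; the sum is empty (hence 0) when b < a.
∑[_⋯_] : ℕ → ℕ → (ℕ → ℚ) → ℚ
∑[ a ⋯ b ] f = sumℚ (applyUpTo (λ k → f (a ℕ.+ k)) (suc b ∸ a))

PowerSeries : Set
PowerSeries = ℕ → ℚ

tail : PowerSeries → PowerSeries
tail f n = f (suc n)

_⋆_ : PowerSeries → PowerSeries → PowerSeries
(f ⋆ g) n = ∑[ 0 ⋯ n ] (λ k → f k * g (n ∸ k))

-- Long division; it is the quotient only for divisors with constant term 1,
-- see quotient-⋆ below.
quotient : PowerSeries → PowerSeries → PowerSeries
quotient f g zero    = f 0
quotient f g (suc n) = quotient (λ m → f (suc m) - f 0 * g (suc m)) g n

1/_! : ℕ → ℚ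
1/ n ! = _/_ 1ℤ (n !) {{n ℕ.!≢0}}

egf : (ℕ → ℚ) → PowerSeries
egf a n = a n * 1/ n !

-- x eˣ
x·exp : PowerSeries
x·exp zero    = 0ℚ
x·exp (suc n) = 1/ n !

-- eˣ - 1
exp-1 : PowerSeries
exp-1 zero    = 0ℚ
exp-1 (suc n) = 1/ suc n !

-- x eˣ / (eˣ - 1), computed after cancelling x from both sides of the fraction.
bernoulliSeries : PowerSeries
bernoulliSeries = quotient (tail x·exp) (tail exp-1)

-- In this convention B 1 = + 1/2.
B : ℕ → ℚ
B n = (ℤ.+ (n !)) / 1 * bernoulliSeries n

quotient-⋆ : ∀ f g → g 0 ≡ 1ℚ → quotient f g ⋆ g ≗ f
quotient-⋆ f g g₀≡1 zero = begin
  f 0 * g 0 + 0ℚ  ≡⟨ ℚ.+-identityʳ _ ⟩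
  f 0 * g 0       ≡⟨ cong (f 0 *_) g₀≡1 ⟩
  f 0 * 1ℚ        ≡⟨ ℚ.*-identityʳ _ ⟩
  f 0             ∎
  where open ≡-Reasoning
quotient-⋆ f g g₀≡1 (suc n) = begin
  c + (quotient f′ g ⋆ g) n  ≡⟨ cong (λ z → c + z) (quotient-⋆ f′ g g₀≡1 n) ⟩
  c + (f (suc n) - c)        ≡⟨ ℚ.+-comm c _ ⟩
  (f (suc n) - c) + c        ≡⟨ ℚ.+-assoc (f (suc n)) (- c) c ⟩
  f (suc n) + (- c + c)      ≡⟨ cong (f (suc n) +_) (ℚ.+-inverseˡ c) ⟩
  f (suc n) + 0ℚ             ≡⟨ ℚ.+-identityʳ _ ⟩
  f (suc n)                  ∎
  where
  open ≡-Reasoning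
  c  = f 0 * g (suc n)
  f′ : PowerSeries
  f′ m = f (suc m) - f 0 * g (suc m)

⋆-tail : ∀ f g → g 0 ≡ 0ℚ → tail (f ⋆ g) ≗ f ⋆ tail g
⋆-tail f g g₀≡0 zero = cong (f 0 * g 1 +_) (begin
  f 1 * g 0 + 0ℚ  ≡⟨ ℚ.+-identityʳ _ ⟩
  f 1 * g 0       ≡⟨ cong (f 1 *_) g₀≡0 ⟩
  f 1 * 0ℚ        ≡⟨ ℚ.*-zeroʳ (f 1) ⟩
  0ℚ              ∎)
  where open ≡-Reasoning
⋆-tail f g g₀≡0 (suc n) =
  cong (f 0 * g (suc (suc n)) +_) (⋆-tail (tail f) g g₀≡0 n)

⋆-congˡ : ∀ {f f′} g → f ≗ f′ → f ⋆ g ≗ f′ ⋆ g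
⋆-congˡ g eq zero    = cong (λ z → z * g 0 + 0ℚ) (eq 0)
⋆-congˡ g eq (suc n) =
  cong₂ (λ z w → z * g (suc n) + w) (eq 0) (⋆-congˡ g (λ k → eq (suc k)) n)

n!*1/n!≡1 : ∀ n → (ℤ.+ (n !)) / 1 * 1/ n ! ≡ 1ℚ
n!*1/n!≡1 n = go (n !) {{n ℕ.!≢0}}
  where
  go : ∀ d .{{_ : ℕ.NonZero d}} → (ℤ.+ d) / 1 * (1ℤ / d) ≡ 1ℚ
  go (suc d) = ℚ.toℚᵘ-injective (begin
    toℚᵘ (ℤ.+ suc d / 1 * (1ℤ / suc d))               ≈⟨ ℚ.toℚᵘ-homo-* (ℤ.+ suc d / 1) (1ℤ / suc d) ⟩
    toℚᵘ (ℤ.+ suc d / 1) ℚᵘ.* toℚᵘ (1ℤ / suc d)     ≈⟨ ℚᵘ.*-cong (ℚ.toℚᵘ-fromℚᵘ (ℤ.+ suc d ℚᵘ./ 1)) (ℚ.toℚᵘ-fromℚᵘ (1ℤ ℚᵘ./ suc d)) ⟩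
    (ℤ.+ suc d ℚᵘ./ 1) ℚᵘ.* (1ℤ ℚᵘ./ suc d)         ≈⟨ ℚᵘ.*≡* (cong ℤ.+_ eq) ⟩
    ℚᵘ.1ℚᵘ                                        ∎)
    where
    open ℚᵘ.≃-Reasoning
    eq : suc d ℕ.* 1 ℕ.* 1 ≡ 1 ℕ.* (1 ℕ.* suc d)
    eq = trans (ℕ.*-identityʳ _) (trans (ℕ.*-comm (suc d) 1) (sym (ℕ.*-identityˡ _)))

egf-B : egf B ≗ bernoulliSeries
egf-B n = begin
  m * b * 1/ n !    ≡⟨ cong (_* 1/ n !) (ℚ.*-comm m b) ⟩
  b * m * 1/ n !    ≡⟨ ℚ.*-assoc b m (1/ n !) ⟩
  b * (m * 1/ n !)  ≡⟨ cong (b *_) (n!*1/n!≡1 n) ⟩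
  b * 1ℚ            ≡⟨ ℚ.*-identityʳ b ⟩
  b                 ∎
  where
  open ≡-Reasoning
  m = (ℤ.+ (n !)) / 1
  b = bernoulliSeries n

-- The defining property of the Bernoulli numbers: Σ Bₙ xⁿ/n! · (eˣ - 1) = x eˣ.
B-generatingFunction : egf B ⋆ exp-1 ≗ x·exp
B-generatingFunction zero    = refl
B-generatingFunction (suc n) = begin
  (egf B ⋆ exp-1) (suc n)            ≡⟨ ⋆-tail (egf B) exp-1 refl n ⟩
  (egf B ⋆ tail exp-1) n             ≡⟨ ⋆-congˡ (tail exp-1) egf-B n ⟩
  (bernoulliSeries ⋆ tail exp-1) n   ≡⟨ quotient-⋆ (tail x·exp) (tail exp-1) refl n ⟩
  x·exp (suc n)                      ∎
  where open ≡-Reasoning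

record FiniteSet (r : ℕ) : Set where
  field
    elements : List (Vec ℕ r)
    unique   : Unique elements

open FiniteSet public

[-1]^_ : ℕ → ℚ
[-1]^ r = (-1ℤ ℤ.^ r) / 1

C : ∀ {r} → FiniteSet r → ℚ
C {r} S = [-1]^ r * sumℚ (map (λ n → productℚ (map (λ nⱼ → B nⱼ * 1/ nⱼ !) (toList n))) (elements S))

-- take j and drop j of (n₁, …, nᵣ) are (n₁, …, nⱼ) and (nⱼ₊₁, …, nᵣ).
InS : (i r : ℕ) → Vec ℕ r → Set
InS i r n =
    sum (toList n) ≡ r
  × (∀ j → 1 ≤ j → j < i → sum (take j (toList n)) < j)
  × (∀ j → i ≤ j → j < r → sum (drop j (toList n)) ≤ r ∸ j)

InS? : ∀ i r n → Dec (InS i r n)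
InS? i r n =
  (sum (toList n) ℕ.≟ r)
  ×-dec map′ (λ h j 1≤j j<i → h j<i 1≤j) (λ h {j} j<i 1≤j → h j 1≤j j<i)
          (ℕ.allUpTo? (λ j → (1 ℕ.≤? j) →-dec (sum (take j (toList n)) ℕ.<? j)) i)
  ×-dec map′ (λ h j i≤j j<r → h j<r i≤j) (λ h {j} j<r i≤j → h j i≤j j<r)
          (ℕ.allUpTo? (λ j → (i ℕ.≤? j) →-dec (sum (drop j (toList n)) ℕ.≤? r ∸ j)) r)

-- All vectors in {0, …, b}ʳ.
box : (b r : ℕ) → List (Vec ℕ r)
box b zero    = [] ∷ []
box b (suc r) = cartesianProductWith _∷_ (upTo (suc b)) (box b r)

box-unique : ∀ b r → Unique (box b r)
box-unique b zero    = [] ∷ []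
box-unique b (suc r) =
  Unique.cartesianProductWith⁺ _∷_ ∷-injective (Unique.upTo⁺ (suc b)) (box-unique b r)

∈-box : ∀ {b r} (n : Vec ℕ r) → sum (toList n) ≤ b → n ∈ box b r
∈-box []      _  = here refl
∈-box (x ∷ n) le = ∈-cartesianProductWith⁺ _∷_
  (∈-upTo⁺ (s≤s (ℕ.≤-trans (ℕ.m≤m+n x _) le)))
  (∈-box n (ℕ.≤-trans (ℕ.m≤n+m _ x) le))

-- Entries of a vector satisfying InS are at most r, so filtering the box
-- loses nothing; see ∈-S.
S : (i r : ℕ) → FiniteSet r
S i r .elements = filter (InS? i r) (box r r)
S i r .unique   = Unique.filter⁺ (InS? i r) (box-unique r r)

∈-S : ∀ i r n → n ∈ elements (S i r) ⇔ InS i r n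
∈-S i r n = mk⇔
  (λ n∈S → proj₂ (∈-filter⁻ (InS? i r) {xs = box r r} n∈S))
  (λ { p@(eq , _) → ∈-filter⁺ (InS? i r) (∈-box n (ℕ.≤-reflexive eq)) p })

C[_,_] : (i r : ℕ) → ℚ
C[ i , r ] = C (S i r)

{-# OPTIONS --safe #-}

-- Read (n₁, …, nᵣ) as a path with heights sⱼ = n₁ + ⋯ + nⱼ - j; then S i r
-- consists of the paths with sᵣ = 0, sⱼ < 0 for 1 ≤ j < i and sⱼ ≥ 0 for
-- i ≤ j < r, and C[ i , r ] sums over them a weight that is a product over the
-- steps, so permuting the steps does not change it.
--
-- Reversing all steps but the first matches S (i + 1) r with S (r - i + 1) r.
-- Cutting a path of S i r at its last zero k < r, where it has one, and
-- reversing the second half gives a pair in S i k × S (r - k) (r - k); the paths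
-- without such a zero have sⱼ < 0 for 1 ≤ j < i and sⱼ > 0 for i ≤ j < r, and
-- full reversal matches those for i with those for r - i + 1.  Comparing the two
-- decompositions gives the recurrence.
--
-- For i = 1, let b(x) = x eˣ / (eˣ - 1) and L = - log (1 - z), so L = z b(L).
-- Building the paths backwards, one step at a time, multiplies by b, and the
-- unsigned sum over the suffixes of length r with entries adding up to d is the
-- coefficient of z^(r + 1) in L^(r + 1 - d), which for d = r is 1 / (r + 1).
module Submission where

open import Defs
open import Algebra.Bundles using (CommutativeMonoid)
open import Data.Integer.Base using (1ℤ; -1ℤ)
import Data.Integer.Base as ℤ
import Data.Integer.Properties as ℤ
open import Data.List.Base
  using (List; []; _∷_; _++_; map; filter; length; take; drop; reverse; concat; cartesianProduct; applyUpTo)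
open import Data.List.Membership.Propositional using (_∈_)
open import Data.List.Membership.Propositional.Properties
  using (∈-map⁺; ∈-map⁻; ∈-filter⁺; ∈-filter⁻; ∈-cartesianProduct⁺; ∈-cartesianProduct⁻;
         ∈-concat⁺′; ∈-concat⁻′; ∈-applyUpTo⁺; ∈-applyUpTo⁻)
open import Data.List.Membership.Propositional.Properties.WithK using (unique∧set⇒bag)
import Data.List.Properties as List
open import Data.List.Relation.Binary.BagAndSetEquality using (∼bag⇒↭)
open import Data.List.Relation.Binary.Permutation.Propositional using (_↭_; prep; ↭-sym; ↭-refl; ↭⇒↭ₛ)
import Data.List.Relation.Binary.Permutation.Propositional.Properties as ↭
import Data.List.Relation.Binary.Permutation.Setoid.Properties as ↭ₛ
open import Data.List.Relation.Unary.All as All using ([]; _∷_)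
import Data.List.Relation.Unary.All.Properties as All
open import Data.List.Relation.Unary.AllPairs using ([]; _∷_)
import Data.List.Relation.Unary.AllPairs.Properties as AllPairs
open import Data.List.Relation.Unary.Any using (here; there)
open import Data.List.Relation.Unary.Unique.Propositional using (Unique)
import Data.List.Relation.Unary.Unique.Propositional.Properties as Unique
open import Data.Nat.Base using (ℕ; zero; suc; _∸_; _!; _≤_; _<_; s≤s; z≤n; s<s; s≤s⁻¹)
import Data.Nat.Base as ℕ
open import Data.Nat.ListAction using (sum)
open import Data.Nat.ListAction.Properties using (sum-++; sum-↭)
import Data.Nat.Properties as ℕ
open import Data.Product.Base using (_×_; _,_; proj₁; ∃-syntax)
open import Data.Rational.Base using (ℚ; 0ℚ; 1ℚ; _+_; _*_; _-_; -_; _/_; toℚᵘ)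
import Data.Rational.Properties as ℚ
open import Algebra.Properties.Group ℚ.+-0-group using (∙-cancelˡ)
open import Data.Rational.Solver using (module +-*-Solver)
import Data.Rational.Unnormalised.Base as ℚᵘ
import Data.Rational.Unnormalised.Properties as ℚᵘ
open import Data.Sum.Base using (inj₁; inj₂)
open import Data.Vec.Base using (Vec; toList; fromList)
import Data.Vec.Properties as Vec
open import Function.Base using (_∘_; id)
open import Function.Bundles using (mk⇔; Equivalence)
open import Relation.Binary.Definitions using (tri<; tri≈; tri>)
open import Relation.Binary.PropositionalEquality
  using (_≡_; _≗_; refl; sym; trans; cong; cong₂; subst; subst₂; module ≡-Reasoning)
open import Relation.Nullary using (¬_; yes; no; contradiction)
open import Relation.Nullary.Decidable using (¬?; _→-dec_)
open import Relation.Unary using (Decidable; ∁; _∩_)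

private
  variable
    A A′ : Set

-- Weighted enumerations

sumℚ-↭ : ∀ {xs ys} → xs ↭ ys → sumℚ xs ≡ sumℚ ys
sumℚ-↭ p = ↭ₛ.foldr-commMonoid M.setoid M.isCommutativeMonoid (↭⇒↭ₛ p)
  where module M = CommutativeMonoid ℚ.+-0-commutativeMonoid

productℚ-↭ : ∀ {xs ys} → xs ↭ ys → productℚ xs ≡ productℚ ys
productℚ-↭ p = ↭ₛ.foldr-commMonoid M.setoid M.isCommutativeMonoid (↭⇒↭ₛ p)
  where module M = CommutativeMonoid ℚ.*-1-commutativeMonoid

sumℚ-++ : ∀ xs ys → sumℚ (xs ++ ys) ≡ sumℚ xs + sumℚ ys
sumℚ-++ []       ys = sym (ℚ.+-identityˡ _)
sumℚ-++ (x ∷ xs) ys = trans (cong (x +_) (sumℚ-++ xs ys)) (sym (ℚ.+-assoc x _ _))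

productℚ-++ : ∀ xs ys → productℚ (xs ++ ys) ≡ productℚ xs * productℚ ys
productℚ-++ []       ys = sym (ℚ.*-identityˡ _)
productℚ-++ (x ∷ xs) ys = trans (cong (x *_) (productℚ-++ xs ys)) (sym (ℚ.*-assoc x _ _))

sumOver : (A → ℚ) → List A → ℚ
sumOver w = sumℚ ∘ map w

sumOver-++ : ∀ (w : A → ℚ) xs ys → sumOver w (xs ++ ys) ≡ sumOver w xs + sumOver w ys
sumOver-++ w xs ys = trans (cong sumℚ (List.map-++ w xs ys)) (sumℚ-++ (map w xs) (map w ys))

sumOver-map : ∀ (w : A′ → ℚ) (f : A → A′) xs → sumOver w (map f xs) ≡ sumOver (w ∘ f) xs
sumOver-map w f xs = cong sumℚ (sym (List.map-∘ xs))

sumOver-cong : ∀ {v w : A → ℚ} xs → (∀ {x} → x ∈ xs → v x ≡ w x) → sumOver v xs ≡ sumOver w xs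
sumOver-cong []       eq = refl
sumOver-cong (x ∷ xs) eq = cong₂ _+_ (eq (here refl)) (sumOver-cong xs (eq ∘ there))

sumOver-*ˡ : ∀ c (w : A → ℚ) xs → sumOver (λ x → c * w x) xs ≡ c * sumOver w xs
sumOver-*ˡ c w []       = sym (ℚ.*-zeroʳ c)
sumOver-*ˡ c w (x ∷ xs) =
  trans (cong (c * w x +_) (sumOver-*ˡ c w xs)) (sym (ℚ.*-distribˡ-+ c _ _))

sumOver-cartesianProduct : ∀ (v : A → ℚ) (w : A′ → ℚ) xs ys →
  sumOver (λ (x , y) → v x * w y) (cartesianProduct xs ys) ≡ sumOver v xs * sumOver w ys
sumOver-cartesianProduct v w []       ys = sym (ℚ.*-zeroˡ (sumOver w ys))
sumOver-cartesianProduct v w (x ∷ xs) ys = begin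
  sumOver u (map (x ,_) ys ++ cartesianProduct xs ys)
    ≡⟨ sumOver-++ u (map (x ,_) ys) _ ⟩
  sumOver u (map (x ,_) ys) + sumOver u (cartesianProduct xs ys)
    ≡⟨ cong₂ _+_ (sumOver-map u (x ,_) ys) (sumOver-cartesianProduct v w xs ys) ⟩
  sumOver (λ y → v x * w y) ys + sumOver v xs * sumOver w ys
    ≡⟨ cong (_+ _) (sumOver-*ˡ (v x) w ys) ⟩
  v x * sumOver w ys + sumOver v xs * sumOver w ys
    ≡⟨ ℚ.*-distribʳ-+ (sumOver w ys) (v x) (sumOver v xs) ⟨
  (v x + sumOver v xs) * sumOver w ys ∎
  where
  open ≡-Reasoning
  u = λ (x , y) → v x * w y

sumOver-filter : {P : A → Set} (P? : Decidable P) (w : A → ℚ) → ∀ xs →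
  sumOver w xs ≡ sumOver w (filter P? xs) + sumOver w (filter (¬? ∘ P?) xs)
sumOver-filter P? w []       = refl
sumOver-filter P? w (x ∷ xs) with P? x
... | yes _ = trans (cong (w x +_) (sumOver-filter P? w xs)) (sym (ℚ.+-assoc (w x) _ _))
... | no  _ = trans (cong (w x +_) (sumOver-filter P? w xs))
  (solve 3 (λ a b c → a :+ (b :+ c) := b :+ (a :+ c)) refl (w x)
    (sumOver w (filter P? xs)) (sumOver w (filter (¬? ∘ P?) xs)))
  where open +-*-Solver

-- Injectivity is asked only on members, because `∑ᴱ-bijection` supplies it only there: its two maps
-- are mutually inverse on the enumerated predicates.
unique-map : (f : A → A′) → ∀ {xs} → (∀ {x y} → x ∈ xs → y ∈ xs → f x ≡ f y → x ≡ y) →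
  Unique xs → Unique (map f xs)
unique-map f inj []           = []
unique-map f inj (x∉xs ∷ xs!) =
  All.map⁺ (All.tabulate (λ y∈ fx≡fy → All.lookup x∉xs y∈ (inj (here refl) (there y∈) fx≡fy)))
  ∷ unique-map f (λ x∈ y∈ → inj (there x∈) (there y∈)) xs!

-- Any two enumerations of the same predicate are permutations of each other, so a sum over one
-- depends only on `P`. Combinatorial identities can thus be argued on predicates, whatever the
-- order of the lists.
record Enumeration {A : Set} (P : A → Set) : Set where
  field
    list     : List A
    unique   : Unique list
    sound    : ∀ {x} → x ∈ list → P x
    complete : ∀ {x} → P x → x ∈ list

open Enumeration

∑ᴱ : {P : A → Set} → (A → ℚ) → Enumeration P → ℚ
∑ᴱ w E = sumOver w (list E)

_×ᴱ_ : {P : A → Set} {Q : A′ → Set} → Enumeration P → Enumeration Q →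
  Enumeration (λ (x , y) → P x × Q y)
(E ×ᴱ F) .list     = cartesianProduct (list E) (list F)
(E ×ᴱ F) .unique   = Unique.cartesianProduct⁺ (unique E) (unique F)
(E ×ᴱ F) .sound    m with ∈-cartesianProduct⁻ (list E) (list F) m
... | x∈ , y∈ = sound E x∈ , sound F y∈
(E ×ᴱ F) .complete (p , q) = ∈-cartesianProduct⁺ (complete E p) (complete F q)

filterᴱ : {P Q : A → Set} → Decidable Q → Enumeration P → Enumeration (P ∩ Q)
filterᴱ Q? E .list   = filter Q? (list E)
filterᴱ Q? E .unique = Unique.filter⁺ Q? (unique E)
filterᴱ Q? E .sound m with ∈-filter⁻ Q? {xs = list E} m
... | x∈ , q = sound E x∈ , q
filterᴱ Q? E .complete (p , q) = ∈-filter⁺ Q? (complete E p) q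

-- The image of `E` under f and the list of `F` are duplicate-free with the same members, hence
-- equal as bags and permutations of each other; a rational sum does not see the order.
∑ᴱ-bijection : {P : A → Set} {Q : A′ → Set} {v : A → ℚ} {w : A′ → ℚ}
  (E : Enumeration P) (F : Enumeration Q) (f : A → A′) (g : A′ → A) →
  (∀ {x} → P x → Q (f x)) → (∀ {y} → Q y → P (g y)) →
  (∀ {x} → P x → g (f x) ≡ x) → (∀ {y} → Q y → f (g y) ≡ y) →
  (∀ {x} → P x → v x ≡ w (f x)) →
  ∑ᴱ v E ≡ ∑ᴱ w F
∑ᴱ-bijection {v = v} {w} E F f g f-maps g-maps gf fg v≡wf = begin
  sumOver v (list E)          ≡⟨ sumOver-cong (list E) (v≡wf ∘ sound E) ⟩
  sumOver (w ∘ f) (list E)    ≡⟨ sumOver-map w f (list E) ⟨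
  sumOver w (map f (list E))  ≡⟨ sumℚ-↭ (↭.map⁺ w image↭) ⟩
  sumOver w (list F)          ∎
  where
  open ≡-Reasoning
  f-inj : ∀ {x y} → x ∈ list E → y ∈ list E → f x ≡ f y → x ≡ y
  f-inj x∈ y∈ eq = trans (sym (gf (sound E x∈))) (trans (cong g eq) (gf (sound E y∈)))
  to : ∀ {y} → y ∈ map f (list E) → y ∈ list F
  to m with ∈-map⁻ f m
  ... | x , x∈ , refl = complete F (f-maps (sound E x∈))
  from : ∀ {y} → y ∈ list F → y ∈ map f (list E)
  from y∈ = subst (_∈ map f (list E)) (fg (sound F y∈))
    (∈-map⁺ f (complete E (g-maps (sound F y∈))))
  image↭ : map f (list E) ↭ list F
  image↭ = ∼bag⇒↭ (unique∧set⇒bag (unique-map f f-inj (unique E)) (unique F) (mk⇔ to from))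

∑ᴱ-⇔ : {P Q : A → Set} {w : A → ℚ} (E : Enumeration P) (F : Enumeration Q) →
  (∀ {x} → P x → Q x) → (∀ {x} → Q x → P x) → ∑ᴱ w E ≡ ∑ᴱ w F
∑ᴱ-⇔ E F to from =
  ∑ᴱ-bijection E F id id to from (λ _ → refl) (λ _ → refl) (λ _ → refl)

∑ᴱ-involution : {P Q : A → Set} {w : A → ℚ} (E : Enumeration P) (F : Enumeration Q) (f : A → A) →
  (∀ {x} → P x → Q (f x)) → (∀ {x} → Q x → P (f x)) →
  (∀ x → f (f x) ≡ x) → (∀ x → w x ≡ w (f x)) → ∑ᴱ w E ≡ ∑ᴱ w F
∑ᴱ-involution E F f f-maps g-maps ff w≡wf =
  ∑ᴱ-bijection E F f f f-maps g-maps (λ _ → ff _) (λ _ → ff _) (λ _ → w≡wf _)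

∑ᴱ-filter : {P Q : A → Set} (Q? : Decidable Q) (w : A → ℚ) (E : Enumeration P) →
  ∑ᴱ w E ≡ ∑ᴱ w (filterᴱ Q? E) + ∑ᴱ w (filterᴱ (¬? ∘ Q?) E)
∑ᴱ-filter Q? w E = sumOver-filter Q? w (list E)

-- Partial sums and paths

-- This carries height conditions across a reversal: when two complementary sums total j + k, an
-- excess of one over k is a deficit of the other below j.
balance-< : ∀ {x y j k} → x ℕ.+ y ≡ j ℕ.+ k → k < y → x < j
balance-< {x} {y} {j} {k} eq k<y = ℕ.+-cancelʳ-< k x j
  (ℕ.<-≤-trans (ℕ.+-monoʳ-< x k<y) (ℕ.≤-reflexive eq))

balance-≤ : ∀ {x y j k} → x ℕ.+ y ≡ j ℕ.+ k → k ≤ y → x ≤ j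
balance-≤ {x} {y} {j} {k} eq k≤y = ℕ.+-cancelʳ-≤ k x j
  (ℕ.≤-trans (ℕ.+-monoʳ-≤ x k≤y) (ℕ.≤-reflexive eq))

weight : (ℕ → ℚ) → List ℕ → ℚ
weight a = productℚ ∘ map a

weight-↭ : ∀ a {xs ys} → xs ↭ ys → weight a xs ≡ weight a ys
weight-↭ a p = productℚ-↭ (↭.map⁺ a p)

weight-++ : ∀ a xs ys → weight a (xs ++ ys) ≡ weight a xs * weight a ys
weight-++ a xs ys = trans (cong productℚ (List.map-++ a xs ys)) (productℚ-++ (map a xs) (map a ys))

psum : List ℕ → ℕ → ℕ
psum l j = sum (take j l)

psum-++-≤ : ∀ u w {j} → j ≤ length u → psum (u ++ w) j ≡ psum u j
psum-++-≤ u       w {zero}  _  = refl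
psum-++-≤ (x ∷ u) w {suc j} le = cong (x ℕ.+_) (psum-++-≤ u w (s≤s⁻¹ le))

psum-++-+ : ∀ u w k → psum (u ++ w) (length u ℕ.+ k) ≡ sum u ℕ.+ psum w k
psum-++-+ []      w k = refl
psum-++-+ (x ∷ u) w k = trans (cong (x ℕ.+_) (psum-++-+ u w k)) (sym (ℕ.+-assoc x _ _))

psum-length : ∀ u → psum u (length u) ≡ sum u
psum-length u = cong sum (List.take-all (length u) u ℕ.≤-refl)

psum+drop : ∀ l j → psum l j ℕ.+ sum (drop j l) ≡ sum l
psum+drop l j = trans (sym (sum-++ (take j l) _)) (cong sum (List.take++drop≡id j l))

sum-reverse : ∀ l → sum (reverse l) ≡ sum l
sum-reverse l = sum-↭ (↭.↭-reverse l)

-- The first j entries of the reversed list are the entries of l after the first k. When the sum of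
-- l equals its length, the height of the reversed path at j is therefore minus the height of l at
-- k.
psum-reverse : ∀ l j k → j ℕ.+ k ≡ length l → psum (reverse l) j ℕ.+ psum l k ≡ sum l
psum-reverse l j k eq = begin
  psum (reverse l) j ℕ.+ psum l k          ≡⟨ cong (ℕ._+ psum l k) lemma ⟩
  sum v ℕ.+ psum l k                       ≡⟨ ℕ.+-comm (sum v) _ ⟩
  psum l k ℕ.+ sum v                       ≡⟨ psum+drop l k ⟩
  sum l                                    ∎
  where
  open ≡-Reasoning
  u = take k l
  v = drop k l
  length-v : length (reverse v) ≡ j
  length-v = trans (List.length-reverse v) (trans (List.length-drop k l)
    (trans (cong (_∸ k) (sym eq)) (ℕ.m+n∸n≡m j k)))
  lemma : psum (reverse l) j ≡ sum v
  lemma = begin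
    psum (reverse l) j
      ≡⟨ cong (λ z → psum (reverse z) j) (List.take++drop≡id k l) ⟨
    psum (reverse (u ++ v)) j                ≡⟨ cong (λ z → psum z j) (List.reverse-++ u v) ⟩
    psum (reverse v ++ reverse u) j          ≡⟨ psum-++-≤ (reverse v) _ (ℕ.≤-reflexive (sym length-v)) ⟩
    psum (reverse v) j                       ≡⟨ cong (psum (reverse v)) length-v ⟨
    psum (reverse v) (length (reverse v))    ≡⟨ psum-length (reverse v) ⟩
    sum (reverse v)                          ≡⟨ sum-reverse v ⟩
    sum v                                    ∎

-- `InS` for lists, which can be cut and concatenated freely, with every condition on prefix sums:
-- as the total is r, a suffix sum of at most r - j is a prefix sum of at least j.
record Path (i r : ℕ) (l : List ℕ) : Set where
  constructor path
  field
    length≡ : length l ≡ r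
    sum≡    : sum l ≡ r
    below   : ∀ {j} → 1 ≤ j → j < i → psum l j < j
    above   : ∀ {j} → i ≤ j → j < r → j ≤ psum l j

open Path

-- The threshold m is independent of the index i of the path. For m = r the condition is vacuous;
-- for m = i it excludes all zeros at i, ..., r - 1. Lowering m from r to i searches for the last
-- zero.
StrictlyAbove : ℕ → ℕ → List ℕ → Set
StrictlyAbove m r l = ∀ {j} → j < r → m ≤ j → j < psum l j

strictlyAbove? : ∀ m r → Decidable (StrictlyAbove m r)
strictlyAbove? m r l = ℕ.allUpTo? (λ j → (m ℕ.≤? j) →-dec (j ℕ.<? psum l j)) r

InS⇒Path : ∀ {i r} (n : Vec ℕ r) → InS i r n → Path i r (toList n)
InS⇒Path n (s , b , a) = path (Vec.length-toList n) s (λ {j} → b j)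
  (λ {j} i≤j j<r → balance-≤
    (trans (ℕ.m+[n∸m]≡n (ℕ.<⇒≤ j<r)) (sym (trans (psum+drop (toList n) j) s))) (a j i≤j j<r))

Path⇒InS : ∀ {i r} (n : Vec ℕ r) → Path i r (toList n) → InS i r n
Path⇒InS n p = sum≡ p , (λ _ → below p) , λ j i≤j j<r → balance-≤
  (trans (trans (ℕ.+-comm _ (psum (toList n) j)) (trans (psum+drop (toList n) j) (sum≡ p)))
    (sym (ℕ.m∸n+n≡m (ℕ.<⇒≤ j<r))))
  (above p i≤j j<r)

toList-surjective : ∀ {A : Set} {r} (l : List A) → length l ≡ r → ∃[ n ] toList {n = r} n ≡ l
toList-surjective l refl = fromList l , Vec.toList∘fromList l

toList-injective : ∀ {A : Set} {r} {m n : Vec A r} → toList m ≡ toList n → m ≡ n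
toList-injective {m = m} {n} eq = trans (sym (Vec.cast-is-id refl m)) (Vec.toList-injective refl m n eq)

-- Stated for any predicate equivalent to `InS` because it serves twice: for `Path` and, at i = 1,
-- for `Ballot`.
S-enumeration : ∀ {i r} {P : List ℕ → Set} → (∀ {l} → P l → length l ≡ r) →
  (∀ (n : Vec ℕ r) → InS i r n → P (toList n)) → (∀ (n : Vec ℕ r) → P (toList n) → InS i r n) →
  Enumeration P
S-enumeration {i} {r} len to from .list   = map toList (elements (S i r))
S-enumeration {i} {r} len to from .unique = Unique.map⁺ toList-injective (FiniteSet.unique (S i r))
S-enumeration {i} {r} len to from .sound m with ∈-map⁻ toList m
... | n , n∈S , refl = to n (Equivalence.to (∈-S i r n) n∈S)
S-enumeration {i} {r} len to from .complete {l} p with toList-surjective l (len p)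
... | n , refl = ∈-map⁺ toList (Equivalence.from (∈-S i r n) (from n p))

paths : ∀ i r → Enumeration (Path i r)
paths i r = S-enumeration length≡ InS⇒Path Path⇒InS

_∩ᴱ_ : ∀ {i r} m → Enumeration (Path i r) → Enumeration (Path i r ∩ StrictlyAbove m r)
_∩ᴱ_ {r = r} m = filterᴱ (strictlyAbove? m r)

-- Reversing paths

reverse-tail : List ℕ → List ℕ
reverse-tail []      = []
reverse-tail (x ∷ l) = x ∷ reverse l

reverse-tail-involutive : ∀ l → reverse-tail (reverse-tail l) ≡ l
reverse-tail-involutive []      = refl
reverse-tail-involutive (x ∷ l) = cong (x ∷_) (List.reverse-involutive l)

reverse-tail-↭ : ∀ l → l ↭ reverse-tail l
reverse-tail-↭ []      = ↭-refl
reverse-tail-↭ (x ∷ l) = prep x (↭-sym (↭.↭-reverse l))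

-- With the leading 0 kept fixed, the new height h′ at j and the old height h at r + 1 - j satisfy
-- h′ = -1 - h. This reflection exchanges negative with non-negative heights, which swaps the roles
-- of a and b.
reverse-tail-Path : ∀ {a b r l} → 1 ≤ a → 1 ≤ b → a ℕ.+ b ≡ r →
  Path (suc a) r l → Path (suc b) r (reverse-tail l)
reverse-tail-Path {l = []} 1≤a 1≤b refl p with length≡ p
... | eq = contradiction (ℕ.≤-trans 1≤a (ℕ.≤-trans (ℕ.m≤m+n _ _) (ℕ.≤-reflexive (sym eq)))) λ ()
-- Since a is positive, `below` applies at position 1 and forces the first entry to be 0.
reverse-tail-Path {a} {b} {l = suc x ∷ l} 1≤a 1≤b refl p = contradiction (below p {1} ℕ.≤-refl (s≤s 1≤a))
  λ { (s≤s ()) }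
reverse-tail-Path {a} {b} {l = zero ∷ l} 1≤a 1≤b refl p = path
  (trans (cong suc (List.length-reverse l)) (length≡ p))
  (trans (sum-reverse l) (sum≡ p))
  below′ above′
  where
  balanced : ∀ j k → suc j ℕ.+ k ≡ a ℕ.+ b → psum (reverse l) j ℕ.+ psum l k ≡ suc j ℕ.+ k
  balanced j k eq = trans
    (psum-reverse l j k (ℕ.suc-injective (trans eq (sym (length≡ p)))))
    (trans (sum≡ p) (sym eq))
  below′ : ∀ {j} → 1 ≤ j → j < suc b → psum (zero ∷ reverse l) j < j
  -- Position 1 corresponds to position r, which `above` leaves out; the leading 0 gives the bound
  -- directly.
  below′ {suc zero}        _ _         = s≤s z≤n
  below′ {suc j@(suc _)} _ (s<s j<b) = balance-< (balanced j k eq) (above p (s≤s a≤k) k<r)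
    where
    k = a ℕ.+ b ∸ suc j
    eq : suc j ℕ.+ k ≡ a ℕ.+ b
    eq = ℕ.m+[n∸m]≡n (ℕ.≤-trans j<b (ℕ.m≤n+m b a))
    a≤k : a ≤ k
    a≤k = balance-≤ (trans (sym eq) (ℕ.+-comm (suc j) k)) j<b
    k<r : suc k < a ℕ.+ b
    k<r = ℕ.<-≤-trans (s≤s (s≤s (ℕ.m≤n+m k _))) (ℕ.≤-reflexive eq)
  above′ : ∀ {j} → suc b ≤ j → j < a ℕ.+ b → j ≤ psum (zero ∷ reverse l) j
  above′ {suc j} (s<s b≤j) j<r =
    balance-≤ (sym (balanced j k eq)) (s≤s⁻¹ (below p (s≤s z≤n) (s≤s k<a)))
    where
    k = a ℕ.+ b ∸ suc j
    eq : suc j ℕ.+ k ≡ a ℕ.+ b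
    eq = ℕ.m+[n∸m]≡n (ℕ.<⇒≤ j<r)
    k<a : k < a
    k<a = balance-< (trans (ℕ.+-comm k (suc j)) eq) (s≤s b≤j)

-- Full reversal turns the height at r - j into its negative at j. Negative and positive heights are
-- exchanged, there being no interior zeros, and a + b = r + 1 makes the two ranges of positions
-- correspond.
reverse-StrictPath : ∀ {a b r l} → 1 ≤ a → 1 ≤ b → a ℕ.+ b ≡ suc r →
  (Path a r ∩ StrictlyAbove a r) l → (Path b r ∩ StrictlyAbove b r) (reverse l)
reverse-StrictPath {a} {b} {r} {l} 1≤a 1≤b a+b≡ (p , strict) =
  path (trans (List.length-reverse l) (length≡ p)) (trans (sum-reverse l) (sum≡ p))
    below′ (λ b≤j j<r → ℕ.<⇒≤ (strict′ j<r b≤j))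
  , strict′
  where
  module _ {j} (j≤r : j ≤ r) where
    k = r ∸ j
    j+k≡r : j ℕ.+ k ≡ r
    j+k≡r = ℕ.m+[n∸m]≡n j≤r
    balanced : psum (reverse l) j ℕ.+ psum l k ≡ j ℕ.+ k
    balanced = trans (psum-reverse l j k (trans j+k≡r (sym (length≡ p)))) (trans (sum≡ p) (sym j+k≡r))
    sums : a ℕ.+ b ≡ suc k ℕ.+ j
    sums = trans a+b≡ (cong suc (trans (sym j+k≡r) (ℕ.+-comm j k)))
  below′ : ∀ {j} → 1 ≤ j → j < b → psum (reverse l) j < j
  below′ {j} 1≤j j<b = balance-< (balanced j≤r) (strict (k<r 1≤j) a≤k)
    where
    j≤r : j ≤ r
    j≤r = s≤s⁻¹ (ℕ.≤-trans j<b (ℕ.≤-trans (ℕ.m≤n+m b a) (ℕ.≤-reflexive a+b≡)))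
    a≤k : a ≤ k j≤r
    a≤k = s≤s⁻¹ (balance-< (sums j≤r) j<b)
    k<r : 1 ≤ j → r ∸ j < r
    k<r 1≤j = balance-< (trans (ℕ.m∸n+n≡m j≤r) (sym (ℕ.+-identityʳ r))) 1≤j
  strict′ : StrictlyAbove b r (reverse l)
  strict′ {j} j<r b≤j = balance-< (sym (balanced j≤r)) (below p 1≤k k<a)
    where
    j≤r = ℕ.<⇒≤ j<r
    1≤k : 1 ≤ r ∸ j
    1≤k = ℕ.m<n⇒0<n∸m j<r
    k<a : r ∸ j < a
    k<a = balance-≤ (sym (sums j≤r)) b≤j

-- Cutting paths at their last zero

join : List ℕ × List ℕ → List ℕ
join (v , w) = v ++ reverse w

split : ℕ → List ℕ → List ℕ × List ℕ
split m l = take m l , reverse (drop m l)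

join-split : ∀ m l → join (split m l) ≡ l
join-split m l = trans (cong (take m l ++_) (List.reverse-involutive (drop m l)))
  (List.take++drop≡id m l)

take-length-++ : ∀ (u w : List ℕ) → take (length u) (u ++ w) ≡ u
take-length-++ []      w = refl
take-length-++ (x ∷ u) w = cong (x ∷_) (take-length-++ u w)

drop-length-++ : ∀ (u w : List ℕ) → drop (length u) (u ++ w) ≡ w
drop-length-++ []      w = refl
drop-length-++ (x ∷ u) w = drop-length-++ u w

split-join : ∀ {m} v w → length v ≡ m → split m (join (v , w)) ≡ (v , w)
split-join v w refl = cong₂ _,_ (take-length-++ v (reverse w))
  (trans (cong reverse (drop-length-++ v (reverse w))) (List.reverse-involutive w))

Returns : ℕ → List ℕ → Set
Returns m l = psum l m ≡ m

psum-take : ∀ m l {j} → j ≤ m → psum (take m l) j ≡ psum l j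
psum-take m l {j} j≤m = cong sum (trans (List.take-take j m l) (cong (λ z → take z l) (ℕ.m≤n⇒m⊓n≡m j≤m)))

psum-drop : ∀ m l k → psum l m ℕ.+ psum (drop m l) k ≡ psum l (m ℕ.+ k)
psum-drop m l k = trans (sym (sum-++ (take m l) _)) (cong sum (take-+ m l))
  where
  take-+ : ∀ m (l : List ℕ) → take m l ++ take k (drop m l) ≡ take (m ℕ.+ k) l
  take-+ zero    l       = refl
  take-+ (suc m) []      = List.take-[] k
  take-+ (suc m) (x ∷ l) = cong (x ∷_) (take-+ m l)

module _ {i m d : ℕ} (i≤m : i ≤ m) (0<d : 0 < d) where

  private
    r = m ℕ.+ d
    m<r : m < r
    m<r = ℕ.m<m+n m 0<d

  -- After the return at m the rest of the path starts and ends at height 0 and is positive in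
  -- between. Reversal makes these heights negative, which is all that `Path d d` asks of them, its
  -- `above` range being empty.
  split-Path : ∀ {l} → ((Path i r ∩ StrictlyAbove (suc m) r) ∩ Returns m) l →
    let (v , w) = split m l in Path i m v × Path d d w
  split-Path {l} ((p , strict) , ret) =
    path length-v ret
      (λ {j} 1≤j j<i → subst (_< j) (sym (psum-take m l (ℕ.<⇒≤ (ℕ.<-≤-trans j<i i≤m)))) (below p 1≤j j<i))
      (λ {j} i≤j j<m → subst (j ≤_) (sym (psum-take m l (ℕ.<⇒≤ j<m))) (above p i≤j (ℕ.<-trans j<m m<r)))
    , path (trans (List.length-reverse u) length-u) (trans (sum-reverse u) sum-u)
      below′ (λ d≤j j<d → contradiction j<d (ℕ.≤⇒≯ d≤j))
    where
    u = drop m l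
    length-v : length (take m l) ≡ m
    length-v = trans (List.length-take m l) (ℕ.m≤n⇒m⊓n≡m
      (ℕ.≤-trans (ℕ.m≤m+n m d) (ℕ.≤-reflexive (sym (length≡ p)))))
    length-u : length u ≡ d
    length-u = trans (List.length-drop m l) (trans (cong (_∸ m) (length≡ p)) (ℕ.m+n∸m≡n m d))
    sum-u : sum u ≡ d
    sum-u = ℕ.+-cancelˡ-≡ m _ _ (trans (cong (ℕ._+ sum u) (sym ret)) (trans (psum+drop l m) (sum≡ p)))
    below′ : ∀ {j} → 1 ≤ j → j < d → psum (reverse u) j < j
    below′ {j} 1≤j j<d = balance-< balanced (ℕ.+-cancelˡ-< m k (psum u k) high)
      where
      k = d ∸ j
      j+k≡d : j ℕ.+ k ≡ d
      j+k≡d = ℕ.m+[n∸m]≡n (ℕ.<⇒≤ j<d)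
      balanced : psum (reverse u) j ℕ.+ psum u k ≡ j ℕ.+ k
      balanced = trans (psum-reverse u j k (trans j+k≡d (sym length-u))) (trans sum-u (sym j+k≡d))
      k<d : k < d
      k<d = balance-< (trans (ℕ.m∸n+n≡m (ℕ.<⇒≤ j<d)) (sym (ℕ.+-identityʳ d))) 1≤j
      high : m ℕ.+ k < m ℕ.+ psum u k
      high = subst (m ℕ.+ k <_) (trans (sym (psum-drop m l k)) (cong (ℕ._+ psum u k) ret))
        (strict (ℕ.+-monoʳ-< m k<d) (ℕ.m<m+n m (ℕ.m<n⇒0<n∸m j<d)))

  join-Path : ∀ {v w} → Path i m v → Path d d w →
    ((Path i r ∩ StrictlyAbove (suc m) r) ∩ Returns m) (join (v , w))
  join-Path {v} {w} p q =
    (path length-l sum-l below′ above′ , λ j<r m<j → high j<r m<j) , ret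
    where
    l = join (v , w)
    length-l : length l ≡ r
    length-l = trans (List.length-++ v) (cong₂ ℕ._+_ (length≡ p) (trans (List.length-reverse w) (length≡ q)))
    sum-l : sum l ≡ r
    sum-l = trans (sum-++ v (reverse w)) (cong₂ ℕ._+_ (sum≡ p) (trans (sum-reverse w) (sum≡ q)))
    low : ∀ {j} → j ≤ m → psum l j ≡ psum v j
    low j≤m = psum-++-≤ v (reverse w) (ℕ.≤-trans j≤m (ℕ.≤-reflexive (sym (length≡ p))))
    ret : Returns m l
    ret = trans (low ℕ.≤-refl) (trans (cong (psum v) (sym (length≡ p))) (trans (psum-length v) (sum≡ p)))
    below′ : ∀ {j} → 1 ≤ j → j < i → psum l j < j
    below′ {j} 1≤j j<i = subst (_< j) (sym (low (ℕ.<⇒≤ (ℕ.<-≤-trans j<i i≤m)))) (below p 1≤j j<i)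
    high : StrictlyAbove (suc m) r l
    high {j} j<r m<j = subst₂ _<_ m+k≡j psum≡
      (ℕ.+-monoʳ-< m (balance-< (sym balanced) (below q (ℕ.m<n⇒0<n∸m k<d) d∸k<d)))
      where
      k = j ∸ m
      m+k≡j : m ℕ.+ k ≡ j
      m+k≡j = ℕ.m+[n∸m]≡n (ℕ.<⇒≤ m<j)
      k<d : k < d
      k<d = ℕ.+-cancelˡ-< m k d (subst (_< r) (sym m+k≡j) j<r)
      k+ : k ℕ.+ (d ∸ k) ≡ d
      k+ = ℕ.m+[n∸m]≡n (ℕ.<⇒≤ k<d)
      d∸k<d : d ∸ k < d
      d∸k<d = balance-< (trans (ℕ.m∸n+n≡m (ℕ.<⇒≤ k<d)) (sym (ℕ.+-identityʳ d))) (ℕ.m<n⇒0<n∸m m<j)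
      balanced : psum (reverse w) k ℕ.+ psum w (d ∸ k) ≡ k ℕ.+ (d ∸ k)
      balanced = trans (psum-reverse w k (d ∸ k) (trans k+ (sym (length≡ q)))) (trans (sum≡ q) (sym k+))
      psum≡ : m ℕ.+ psum (reverse w) k ≡ psum l j
      psum≡ = begin
        m ℕ.+ psum (reverse w) k      ≡⟨ cong (ℕ._+ psum (reverse w) k) (sum≡ p) ⟨
        sum v ℕ.+ psum (reverse w) k  ≡⟨ psum-++-+ v (reverse w) k ⟨
        psum l (length v ℕ.+ k)       ≡⟨ cong (λ z → psum l (z ℕ.+ k)) (length≡ p) ⟩
        psum l (m ℕ.+ k)              ≡⟨ cong (psum l) m+k≡j ⟩
        psum l j                      ∎
        where open ≡-Reasoning
    above′ : ∀ {j} → i ≤ j → j < r → j ≤ psum l j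
    above′ {j} i≤j j<r with ℕ.<-cmp j m
    ... | tri< j<m _ _  = subst (j ≤_) (sym (low (ℕ.<⇒≤ j<m))) (above p i≤j j<m)
    ... | tri≈ _ refl _ = ℕ.≤-reflexive (sym ret)
    ... | tri> _ _ m<j  = ℕ.<⇒≤ (high j<r m<j)

  module _ (a : ℕ → ℚ) where

    -- A path without zeros strictly between m and r either has a zero at m, which is then its last
    -- one and cuts it into an independent pair, or has none there and is strictly above from m on.
    last-return :
      ∑ᴱ (weight a) (suc m ∩ᴱ paths i r)
        ≡ ∑ᴱ (weight a) (m ∩ᴱ paths i r)
        + ∑ᴱ (weight a) (paths i m) * ∑ᴱ (weight a) (paths d d)
    last-return = begin
      ∑ᴱ (weight a) E
        ≡⟨ ∑ᴱ-filter returns? (weight a) E ⟩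
      ∑ᴱ (weight a) (filterᴱ returns? E) + ∑ᴱ (weight a) (filterᴱ (¬? ∘ returns?) E)
        ≡⟨ ℚ.+-comm (∑ᴱ (weight a) (filterᴱ returns? E)) _ ⟩
      ∑ᴱ (weight a) (filterᴱ (¬? ∘ returns?) E) + ∑ᴱ (weight a) (filterᴱ returns? E)
        ≡⟨ cong₂ _+_ (∑ᴱ-⇔ (filterᴱ (¬? ∘ returns?) E) (m ∩ᴱ paths i r) to from)
             (∑ᴱ-bijection (filterᴱ returns? E) (paths i m ×ᴱ paths d d) (split m) join
               split-Path (λ (p , q) → join-Path p q)
               (λ _ → join-split m _) (λ { {v , w} (p , _) → split-join v w (length≡ p) })
               (λ {l} _ → weight-split l)) ⟩
      ∑ᴱ (weight a) (m ∩ᴱ paths i r) + ∑ᴱ (λ (v , w) → weight a v * weight a w) (paths i m ×ᴱ paths d d)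
        ≡⟨ cong (∑ᴱ (weight a) (m ∩ᴱ paths i r) +_)
             (sumOver-cartesianProduct (weight a) (weight a) (list (paths i m)) (list (paths d d))) ⟩
      ∑ᴱ (weight a) (m ∩ᴱ paths i r) + ∑ᴱ (weight a) (paths i m) * ∑ᴱ (weight a) (paths d d) ∎
      where
      open ≡-Reasoning
      E = suc m ∩ᴱ paths i r
      returns? : Decidable (Returns m)
      returns? l = psum l m ℕ.≟ m
      to : ∀ {l} → ((Path i r ∩ StrictlyAbove (suc m) r) ∩ ∁ (Returns m)) l →
        (Path i r ∩ StrictlyAbove m r) l
      to {l} ((p , strict) , ¬ret) = p , strict′
        where
        strict′ : StrictlyAbove m r l
        strict′ {j} j<r m≤j with m ℕ.≟ j
        ... | yes refl = ℕ.≤∧≢⇒< (above p i≤m j<r) (¬ret ∘ sym)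
        ... | no m≢j   = strict j<r (ℕ.≤∧≢⇒< m≤j m≢j)
      from : ∀ {l} → (Path i r ∩ StrictlyAbove m r) l →
        ((Path i r ∩ StrictlyAbove (suc m) r) ∩ ∁ (Returns m)) l
      from (p , strict) = (p , λ j<r m<j → strict j<r (ℕ.<⇒≤ m<j))
        , λ ret → ℕ.<-irrefl (sym ret) (strict m<r ℕ.≤-refl)
      weight-split : ∀ l → weight a l ≡ weight a (take m l) * weight a (reverse (drop m l))
      weight-split l = trans (cong (weight a) (sym (join-split m l)))
        (trans (weight-++ a (take m l) _)
          (cong (weight a (take m l) *_) (weight-↭ a (↭.↭-reverse (reverse (drop m l))))))

-- The recurrence

-- Checked on unnormalised fractions, where multiplication acts on numerators and denominators
-- separately.
/-* : ∀ i j m n .{{_ : ℕ.NonZero m}} .{{_ : ℕ.NonZero n}} .{{_ : ℕ.NonZero (m ℕ.* n)}} →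
  (i / m) * (j / n) ≡ (i ℤ.* j) / (m ℕ.* n)
/-* i j m@(suc _) n@(suc _) = ℚ.toℚᵘ-injective (begin
  toℚᵘ (i / m * (j / n))          ≈⟨ ℚ.toℚᵘ-homo-* (i / m) (j / n) ⟩
  toℚᵘ (i / m) ℚᵘ.* toℚᵘ (j / n)  ≈⟨ ℚᵘ.*-cong (ℚ.toℚᵘ-fromℚᵘ (i ℚᵘ./ m)) (ℚ.toℚᵘ-fromℚᵘ (j ℚᵘ./ n)) ⟩
  (i ℚᵘ./ m) ℚᵘ.* (j ℚᵘ./ n)      ≈⟨ ℚ.toℚᵘ-fromℚᵘ ((i ℤ.* j) ℚᵘ./ (m ℕ.* n)) ⟨
  toℚᵘ ((i ℤ.* j) / (m ℕ.* n))    ∎)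
  where open ℚᵘ.≃-Reasoning

[-1]^-suc : ∀ r → [-1]^ suc r ≡ - ([-1]^ r)
[-1]^-suc r = begin
  [-1]^ suc r       ≡⟨ /-* -1ℤ (-1ℤ ℤ.^ r) 1 1 ⟨
  - 1ℚ * [-1]^ r    ≡⟨ ℚ.neg-distribˡ-* 1ℚ ([-1]^ r) ⟨
  - (1ℚ * [-1]^ r)  ≡⟨ cong -_ (ℚ.*-identityˡ ([-1]^ r)) ⟩
  - ([-1]^ r)       ∎
  where open ≡-Reasoning

b : PowerSeries
b = egf B

weight-neg : ∀ a l → weight (-_ ∘ a) l ≡ [-1]^ (length l) * weight a l
weight-neg a []      = refl
weight-neg a (x ∷ l) = begin
  - a x * weight (-_ ∘ a) l              ≡⟨ cong (- a x *_) (weight-neg a l) ⟩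
  - a x * ([-1]^ length l * weight a l)
    ≡⟨ solve 3 (λ x s w → :- x :* (s :* w) := :- s :* (x :* w)) refl
        (a x) ([-1]^ length l) (weight a l) ⟩
  - ([-1]^ length l) * weight a (x ∷ l)  ≡⟨ cong (_* weight a (x ∷ l)) ([-1]^-suc (length l)) ⟨
  [-1]^ suc (length l) * weight a (x ∷ l) ∎
  where
  open ≡-Reasoning
  open +-*-Solver

C-toList : ∀ {r} (S : FiniteSet r) → C S ≡ [-1]^ r * sumOver (weight b) (map toList (elements S))
C-toList {r} S = cong ([-1]^ r *_) (sym (sumOver-map (weight b) toList (elements S)))

-- The global sign is spread over the entries as `-_ ∘ b`. The weight stays multiplicative under
-- concatenation, so products of values of C arise from `last-return` without extra signs.
C-paths : ∀ i r → C[ i , r ] ≡ ∑ᴱ (weight (-_ ∘ b)) (paths i r)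
C-paths i r = begin
  C[ i , r ]                                       ≡⟨ C-toList (S i r) ⟩
  [-1]^ r * sumOver (weight b) ls                  ≡⟨ sumOver-*ˡ ([-1]^ r) (weight b) ls ⟨
  sumOver (λ l → [-1]^ r * weight b l) ls          ≡⟨ sumOver-cong ls (λ {l} l∈ → trans
    (cong (λ n → [-1]^ n * weight b l) (sym (length≡ (sound (paths i r) l∈)))) (sym (weight-neg b l))) ⟩
  ∑ᴱ (weight (-_ ∘ b)) (paths i r)                 ∎
  where
  open ≡-Reasoning
  ls = list (paths i r)

-- The contribution to `C[ i , r ]` of the paths that have no zero strictly between 0 and r.
Cˢ : ℕ → ℕ → ℚ
Cˢ i r = ∑ᴱ (weight (-_ ∘ b)) (i ∩ᴱ paths i r)

telescope : ∀ (T g : ℕ → ℚ) a n → (∀ j → j < n → T (suc (a ℕ.+ j)) ≡ T (a ℕ.+ j) + g j) →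
  T (a ℕ.+ n) ≡ T a + sumℚ (applyUpTo g n)
telescope T g a zero    step = trans (cong T (ℕ.+-identityʳ a)) (sym (ℚ.+-identityʳ _))
telescope T g a (suc n) step = begin
  T (a ℕ.+ suc n)                                    ≡⟨ cong T (ℕ.+-suc a n) ⟩
  T (suc a ℕ.+ n)                                    ≡⟨ telescope T (g ∘ suc) (suc a) n step′ ⟩
  T (suc a) + sumℚ (applyUpTo (g ∘ suc) n)           ≡⟨ cong (_+ _) first ⟩
  (T a + g 0) + sumℚ (applyUpTo (g ∘ suc) n)         ≡⟨ ℚ.+-assoc (T a) (g 0) _ ⟩
  T a + sumℚ (applyUpTo g (suc n))                   ∎
  where
  open ≡-Reasoning
  first : T (suc a) ≡ T a + g 0
  first = subst (λ z → T (suc z) ≡ T z + g 0) (ℕ.+-identityʳ a) (step 0 (s≤s z≤n))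
  step′ : ∀ j → j < n → T (suc (suc a ℕ.+ j)) ≡ T (suc a ℕ.+ j) + g (suc j)
  step′ j j<n = subst (λ z → T (suc z) ≡ T z + g (suc j)) (ℕ.+-suc a j) (step (suc j) (s≤s j<n))

-- Telescoping `last-return` over the thresholds from i to r sorts the paths by their last zero k <
-- r with i ≤ k.
decompose : ∀ i r → 1 ≤ r → i ≤ r →
  C[ i , r ] ≡ Cˢ i r + ∑[ i ⋯ r ∸ 1 ] (λ k → C[ i , k ] * C[ r ∸ k , r ∸ k ])
-- With r a successor, the number of summands `suc (r ∸ 1) ∸ i` computes to `r ∸ i`.
decompose i r@(suc _) 1≤r i≤r = begin
  C[ i , r ]             ≡⟨ C-paths i r ⟩
  -- At threshold r the strictness condition is vacuous.
  ∑ᴱ w (paths i r)       ≡⟨ ∑ᴱ-⇔ (paths i r) (r ∩ᴱ paths i r) (λ p → p , λ j<r r≤j → contradiction r≤j (ℕ.<⇒≱ j<r)) proj₁ ⟩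
  T r                    ≡⟨ cong T (ℕ.m+[n∸m]≡n i≤r) ⟨
  T (i ℕ.+ (r ∸ i))      ≡⟨ telescope T (λ j → term (i ℕ.+ j)) i (r ∸ i) step ⟩
  Cˢ i r + ∑[ i ⋯ r ∸ 1 ] term ∎
  where
  open ≡-Reasoning
  w = weight (-_ ∘ b)
  T : ℕ → ℚ
  T m = ∑ᴱ w (m ∩ᴱ paths i r)
  term : ℕ → ℚ
  term k = C[ i , k ] * C[ r ∸ k , r ∸ k ]
  shift : ∀ {m d r} → i ≤ m → 0 < d → m ℕ.+ d ≡ r →
    ∑ᴱ w (suc m ∩ᴱ paths i r) ≡ ∑ᴱ w (m ∩ᴱ paths i r) + ∑ᴱ w (paths i m) * ∑ᴱ w (paths d d)
  shift i≤m 0<d refl = last-return i≤m 0<d (-_ ∘ b)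
  step : ∀ j → j < r ∸ i → T (suc (i ℕ.+ j)) ≡ T (i ℕ.+ j) + term (i ℕ.+ j)
  step j j<n = trans
    (shift (ℕ.m≤m+n i j) (ℕ.m<n⇒0<n∸m m<r) (ℕ.m+[n∸m]≡n (ℕ.<⇒≤ m<r)))
    (cong (T m +_) (sym (cong₂ _*_ (C-paths i m) (C-paths (r ∸ m) (r ∸ m)))))
    where
    m = i ℕ.+ j
    m<r : m < r
    m<r = ℕ.<-≤-trans (ℕ.+-monoʳ-< i j<n) (ℕ.≤-reflexive (ℕ.m+[n∸m]≡n i≤r))

C-symmetric : ∀ {i j r} → 1 ≤ i → 1 ≤ j → i ℕ.+ j ≡ r → C[ suc i , r ] ≡ C[ suc j , r ]
C-symmetric {i} {j} {r} 1≤i 1≤j i+j≡r = trans (C-paths (suc i) r) (trans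
  (∑ᴱ-involution (paths (suc i) r) (paths (suc j) r) reverse-tail
    (reverse-tail-Path 1≤i 1≤j i+j≡r) (reverse-tail-Path 1≤j 1≤i (trans (ℕ.+-comm j i) i+j≡r))
    reverse-tail-involutive (λ l → weight-↭ (-_ ∘ b) (reverse-tail-↭ l)))
  (sym (C-paths (suc j) r)))

Cˢ-symmetric : ∀ {i j r} → 1 ≤ i → 1 ≤ j → i ℕ.+ j ≡ suc r → Cˢ i r ≡ Cˢ j r
Cˢ-symmetric {i} {j} {r} 1≤i 1≤j i+j≡ =
  ∑ᴱ-involution (i ∩ᴱ paths i r) (j ∩ᴱ paths j r) reverse
    (reverse-StrictPath 1≤i 1≤j i+j≡) (reverse-StrictPath 1≤j 1≤i (trans (ℕ.+-comm j i) i+j≡))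
    List.reverse-involutive (λ l → weight-↭ (-_ ∘ b) (↭-sym (↭.↭-reverse l)))

-- `C-symmetric` turns the index i + 1 into r - i + 1. Since r - i + 1 and i add up to r + 1, the
-- decompositions for these two indices have equal strict parts, and only the sums over last zeros
-- differ.
recurrence : ∀ i r → 1 ≤ i → i < r →
  C[ i ℕ.+ 1 , r ]
    ≡ C[ i , r ]
    + ∑[ r ∸ i ℕ.+ 1 ⋯ r ∸ 1 ] (λ k → C[ r ∸ i ℕ.+ 1 , k ] * C[ r ∸ k , r ∸ k ])
    - ∑[ i ⋯ r ∸ 1 ] (λ k → C[ i , k ] * C[ r ∸ k , r ∸ k ])
recurrence i r 1≤i i<r = begin
  C[ i ℕ.+ 1 , r ]      ≡⟨ cong C[_, r ] (ℕ.+-comm i 1) ⟩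
  C[ suc i , r ]        ≡⟨ C-symmetric 1≤i 0<r∸i i+ ⟩
  C[ suc (r ∸ i) , r ]  ≡⟨ cong C[_, r ] (ℕ.+-comm 1 (r ∸ i)) ⟩
  C[ i′ , r ]           ≡⟨ decompose i′ r 1≤r i′≤r ⟩
  Cˢ i′ r + P i′         ≡⟨ cong (_+ P i′) (Cˢ-symmetric (ℕ.m≤n+m 1 (r ∸ i)) 1≤i i′+i) ⟩
  Cˢ i r + P i′
    ≡⟨ solve 3 (λ y p p′ → y :+ p′ := ((y :+ p) :+ p′) :- p) refl (Cˢ i r) (P i) (P i′) ⟩
  Cˢ i r + P i + P i′ - P i ≡⟨ cong (λ z → z + P i′ - P i) (decompose i r 1≤r (ℕ.<⇒≤ i<r)) ⟨
  C[ i , r ] + P i′ - P i ∎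
  where
  open ≡-Reasoning
  open +-*-Solver
  P : ℕ → ℚ
  P a = ∑[ a ⋯ r ∸ 1 ] (λ k → C[ a , k ] * C[ r ∸ k , r ∸ k ])
  i′ = r ∸ i ℕ.+ 1
  0<r∸i : 0 < r ∸ i
  0<r∸i = ℕ.m<n⇒0<n∸m i<r
  i+ : i ℕ.+ (r ∸ i) ≡ r
  i+ = ℕ.m+[n∸m]≡n (ℕ.<⇒≤ i<r)
  1≤r : 1 ≤ r
  1≤r = ℕ.≤-trans 1≤i (ℕ.<⇒≤ i<r)
  i′+i : i′ ℕ.+ i ≡ suc r
  i′+i = trans (cong (ℕ._+ i) (ℕ.+-comm (r ∸ i) 1)) (cong suc (ℕ.m∸n+n≡m (ℕ.<⇒≤ i<r)))
  i′≤r : i′ ≤ r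
  i′≤r = s≤s⁻¹ (balance-< (trans i′+i (sym (ℕ.+-identityʳ (suc r)))) 1≤i)

-- Natural numbers in ℚ

ι : ℕ → ℚ
ι n = ℤ.+ n / 1

1/suc : ℕ → ℚ
1/suc n = 1ℤ / suc n

ι-suc : ∀ n → ι (suc n) ≡ ι n + 1ℚ
ι-suc n = ℚ.toℚᵘ-injective (begin
  toℚᵘ (ι (suc n))                  ≈⟨ ℚ.toℚᵘ-fromℚᵘ (ℤ.+ suc n ℚᵘ./ 1) ⟩
  ℤ.+ suc n ℚᵘ./ 1                  ≈⟨ ℚᵘ.*≡* eq ⟩
  (ℤ.+ n ℚᵘ./ 1) ℚᵘ.+ ℚᵘ.1ℚᵘ        ≈⟨ ℚᵘ.+-congˡ _ (ℚ.toℚᵘ-fromℚᵘ (ℤ.+ n ℚᵘ./ 1)) ⟨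
  toℚᵘ (ι n) ℚᵘ.+ ℚᵘ.1ℚᵘ            ≈⟨ ℚ.toℚᵘ-homo-+ (ι n) 1ℚ ⟨
  toℚᵘ (ι n + 1ℚ)                   ∎)
  where
  open ℚᵘ.≃-Reasoning
  eq : ℤ.+ suc n ℤ.* 1ℤ ≡ (ℤ.+ n ℤ.* 1ℤ ℤ.+ 1ℤ) ℤ.* 1ℤ
  eq = cong (ℤ._* 1ℤ) (trans (cong ℤ.+_ (ℕ.+-comm 1 n)) (cong (ℤ._+ 1ℤ) (sym (ℤ.*-identityʳ (ℤ.+ n)))))

ι*1/suc : ∀ n → ι (suc n) * 1/suc n ≡ 1ℚ
ι*1/suc n = ℚ.toℚᵘ-injective (begin
  toℚᵘ (ι (suc n) * 1/suc n)                      ≈⟨ ℚ.toℚᵘ-homo-* (ι (suc n)) (1/suc n) ⟩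
  toℚᵘ (ι (suc n)) ℚᵘ.* toℚᵘ (1/suc n)
    ≈⟨ ℚᵘ.*-cong (ℚ.toℚᵘ-fromℚᵘ (ℤ.+ suc n ℚᵘ./ 1)) (ℚ.toℚᵘ-fromℚᵘ (1ℤ ℚᵘ./ suc n)) ⟩
  (ℤ.+ suc n ℚᵘ./ 1) ℚᵘ.* (1ℤ ℚᵘ./ suc n)         ≈⟨ ℚᵘ.*≡* (cong ℤ.+_ eq) ⟩
  ℚᵘ.1ℚᵘ                                          ∎)
  where
  open ℚᵘ.≃-Reasoning
  eq : suc n ℕ.* 1 ℕ.* 1 ≡ 1 ℕ.* (1 ℕ.* suc n)
  eq = trans (ℕ.*-identityʳ _) (trans (ℕ.*-comm (suc n) 1) (sym (ℕ.*-identityˡ _)))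

ι-cancel : ∀ n {p q} → ι (suc n) * p ≡ ι (suc n) * q → p ≡ q
ι-cancel n {p} {q} eq = trans (sym (lemma p)) (trans (cong (1/suc n *_) eq) (lemma q))
  where
  lemma : ∀ x → 1/suc n * (ι (suc n) * x) ≡ x
  lemma x = trans (sym (ℚ.*-assoc (1/suc n) (ι (suc n)) x))
    (trans (cong (_* x) (trans (ℚ.*-comm (1/suc n) (ι (suc n))) (ι*1/suc n))) (ℚ.*-identityˡ x))

1/suc! : ∀ n → ι (suc n) * 1/ suc n ! ≡ 1/ n !
1/suc! n = begin
  ι (suc n) * 1/ suc n !
    ≡⟨ cong (ι (suc n) *_) (/-* 1ℤ 1ℤ (suc n) (n !) {{_}} {{n ℕ.!≢0}} {{suc n ℕ.!≢0}}) ⟨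
  ι (suc n) * (1/suc n * 1/ n !)      ≡⟨ ℚ.*-assoc (ι (suc n)) (1/suc n) (1/ n !) ⟨
  ι (suc n) * 1/suc n * 1/ n !        ≡⟨ cong (_* 1/ n !) (ι*1/suc n) ⟩
  1ℚ * 1/ n !                         ≡⟨ ℚ.*-identityˡ (1/ n !) ⟩
  1/ n !                              ∎
  where open ≡-Reasoning

-- Power series

⋆-congʳ : ∀ f {g g′} → g ≗ g′ → f ⋆ g ≗ f ⋆ g′
⋆-congʳ f eq zero    = cong (λ z → f 0 * z + 0ℚ) (eq 0)
⋆-congʳ f eq (suc n) = cong₂ (λ z w → f 0 * z + w) (eq (suc n)) (⋆-congʳ (tail f) eq n)

⋆-cong-≤ : ∀ {f f′} g n → (∀ k → k ≤ n → f k ≡ f′ k) → (f ⋆ g) n ≡ (f′ ⋆ g) n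
⋆-cong-≤ g zero    eq = cong (λ z → z * g 0 + 0ℚ) (eq 0 z≤n)
⋆-cong-≤ g (suc n) eq =
  cong₂ (λ z w → z * g (suc n) + w) (eq 0 z≤n) (⋆-cong-≤ g n (λ k k≤n → eq (suc k) (s≤s k≤n)))

⋆-distribʳ : ∀ f g h n → ((λ k → f k + g k) ⋆ h) n ≡ (f ⋆ h) n + (g ⋆ h) n
⋆-distribʳ f g h zero    =
  solve 3 (λ a b c → (a :+ b) :* c :+ con 0ℚ := (a :* c :+ con 0ℚ) :+ (b :* c :+ con 0ℚ)) refl
        (f 0) (g 0) (h 0)
  where open +-*-Solver
⋆-distribʳ f g h (suc n) = trans
  (cong ((f 0 + g 0) * h (suc n) +_) (⋆-distribʳ (tail f) (tail g) h n))
  (solve 5 (λ a b c x y → (a :+ b) :* c :+ (x :+ y) := (a :* c :+ x) :+ (b :* c :+ y)) refl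
    (f 0) (g 0) (h (suc n)) ((tail f ⋆ h) n) ((tail g ⋆ h) n))
  where open +-*-Solver

⋆-scaleˡ : ∀ c f g n → ((λ k → c * f k) ⋆ g) n ≡ c * (f ⋆ g) n
⋆-scaleˡ c f g zero    =
  solve 3 (λ c a b → (c :* a) :* b :+ con 0ℚ := c :* (a :* b :+ con 0ℚ)) refl c (f 0) (g 0)
  where open +-*-Solver
⋆-scaleˡ c f g (suc n) = trans
  (cong (c * f 0 * g (suc n) +_) (⋆-scaleˡ c (tail f) g n))
  (solve 4 (λ c a b x → (c :* a) :* b :+ c :* x := c :* (a :* b :+ x)) refl
    c (f 0) (g (suc n)) ((tail f ⋆ g) n))
  where open +-*-Solver

⋆-assoc : ∀ f g h → (f ⋆ g) ⋆ h ≗ f ⋆ (g ⋆ h)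
⋆-assoc f g h zero    =
  solve 3 (λ a b c → (a :* b :+ con 0ℚ) :* c :+ con 0ℚ := a :* (b :* c :+ con 0ℚ) :+ con 0ℚ) refl
        (f 0) (g 0) (h 0)
  where open +-*-Solver
⋆-assoc f g h (suc n) = begin
  (f ⋆ g) 0 * h (suc n) + (tail (f ⋆ g) ⋆ h) n
    ≡⟨ cong ((f ⋆ g) 0 * h (suc n) +_) (begin
         (tail (f ⋆ g) ⋆ h) n
           ≡⟨ ⋆-distribʳ (λ k → f 0 * tail g k) (tail f ⋆ g) h n ⟩
         ((λ k → f 0 * tail g k) ⋆ h) n + ((tail f ⋆ g) ⋆ h) n
           ≡⟨ cong₂ _+_ (⋆-scaleˡ (f 0) (tail g) h n) (⋆-assoc (tail f) g h n) ⟩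
         f 0 * (tail g ⋆ h) n + (tail f ⋆ (g ⋆ h)) n ∎) ⟩
  (f 0 * g 0 + 0ℚ) * h (suc n) + (f 0 * (tail g ⋆ h) n + (tail f ⋆ (g ⋆ h)) n)
    ≡⟨ solve 5 (λ a b c x y → (a :* b :+ con 0ℚ) :* c :+ (a :* x :+ y) := a :* (b :* c :+ x) :+ y) refl
         (f 0) (g 0) (h (suc n)) ((tail g ⋆ h) n) ((tail f ⋆ (g ⋆ h)) n) ⟩
  f 0 * (g 0 * h (suc n) + (tail g ⋆ h) n) + (tail f ⋆ (g ⋆ h)) n ∎
  where
  open ≡-Reasoning
  open +-*-Solver

-- As g has constant term 1, the coefficients of the left factor are determined one after another.
-- The truncated form fits `logPower-⋆-b`, where the products are compared only up to degree n.
⋆-cancelʳ-≤ : ∀ {f f′} g → g 0 ≡ 1ℚ → ∀ n →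
  (∀ d → d ≤ n → (f ⋆ g) d ≡ (f′ ⋆ g) d) → ∀ d → d ≤ n → f d ≡ f′ d
⋆-cancelʳ-≤ {f} {f′} g g₀≡1 n eq zero _ = trans (sym (constant f)) (trans (eq 0 z≤n) (constant f′))
  where
  constant : ∀ f → (f ⋆ g) 0 ≡ f 0
  constant f = trans (ℚ.+-identityʳ _) (trans (cong (f 0 *_) g₀≡1) (ℚ.*-identityʳ (f 0)))
⋆-cancelʳ-≤ {f} {f′} g g₀≡1 (suc n) eq (suc d) (s≤s d≤n) =
  ⋆-cancelʳ-≤ {tail f} {tail f′} g g₀≡1 n eq′ d d≤n
  where
  head≡ : f 0 ≡ f′ 0
  head≡ = ⋆-cancelʳ-≤ {f} {f′} g g₀≡1 (suc n) eq 0 z≤n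
  eq′ : ∀ d → d ≤ n → (tail f ⋆ g) d ≡ (tail f′ ⋆ g) d
  eq′ d d≤n = ∙-cancelˡ (f 0 * g (suc d)) ((tail f ⋆ g) d) ((tail f′ ⋆ g) d)
    (trans (eq (suc d) (s≤s d≤n)) (cong (λ z → z * g (suc d) + (tail f′ ⋆ g) d) (sym head≡)))

shift : PowerSeries → PowerSeries
shift f zero    = 0ℚ
shift f (suc n) = f n

shift-⋆ : ∀ f g → shift f ⋆ g ≗ shift (f ⋆ g)
shift-⋆ f g zero    = trans (ℚ.+-identityʳ _) (ℚ.*-zeroˡ (g 0))
shift-⋆ f g (suc n) = trans (cong (_+ (f ⋆ g) n) (ℚ.*-zeroˡ (g (suc n)))) (ℚ.+-identityˡ _)

-- x d/dx
θ : PowerSeries → PowerSeries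
θ f n = ι n * f n

-- The Leibniz rule. In the induction `θ` and `tail` commute up to an extra `tail f`, which `tail-θ`
-- absorbs.
θ-⋆ : ∀ f g n → θ (f ⋆ g) n ≡ (θ f ⋆ g) n + (f ⋆ θ g) n
θ-⋆ f g zero    =
  solve 2 (λ a b → con 0ℚ :* (a :* b :+ con 0ℚ) := (con 0ℚ :* a :* b :+ con 0ℚ) :+ (a :* (con 0ℚ :* b) :+ con 0ℚ)) refl
        (f 0) (g 0)
  where open +-*-Solver
θ-⋆ f g (suc n) = begin
  ι (suc n) * (f 0 * g (suc n) + (tail f ⋆ g) n)
    ≡⟨ cong (_* (f 0 * g (suc n) + (tail f ⋆ g) n)) (ι-suc n) ⟩
  (ι n + 1ℚ) * (f 0 * g (suc n) + (tail f ⋆ g) n)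
    ≡⟨ solve 4 (λ i a c x → (i :+ con 1ℚ) :* (a :* c :+ x) := i :* x :+ ((i :+ con 1ℚ) :* (a :* c) :+ x)) refl
         (ι n) (f 0) (g (suc n)) ((tail f ⋆ g) n) ⟩
  ι n * (tail f ⋆ g) n + ((ι n + 1ℚ) * (f 0 * g (suc n)) + (tail f ⋆ g) n)
    ≡⟨ cong₂ (λ z i → z + (i * (f 0 * g (suc n)) + (tail f ⋆ g) n)) (θ-⋆ (tail f) g n) (sym (ι-suc n)) ⟩
  (θ (tail f) ⋆ g) n + (tail f ⋆ θ g) n + (ι (suc n) * (f 0 * g (suc n)) + (tail f ⋆ g) n)
    ≡⟨ solve 6 (λ i a c x y z → x :+ y :+ (i :* (a :* c) :+ z)
                  := con 0ℚ :* a :* c :+ (x :+ z) :+ (a :* (i :* c) :+ y)) refl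
         (ι (suc n)) (f 0) (g (suc n)) ((θ (tail f) ⋆ g) n) ((tail f ⋆ θ g) n) ((tail f ⋆ g) n) ⟩
  0ℚ * f 0 * g (suc n) + ((θ (tail f) ⋆ g) n + (tail f ⋆ g) n) + (f 0 * (ι (suc n) * g (suc n)) + (tail f ⋆ θ g) n)
    ≡⟨ cong (λ z → 0ℚ * f 0 * g (suc n) + z + (f ⋆ θ g) (suc n)) (begin
         (θ (tail f) ⋆ g) n + (tail f ⋆ g) n          ≡⟨ ⋆-distribʳ (θ (tail f)) (tail f) g n ⟨
         ((λ k → θ (tail f) k + tail f k) ⋆ g) n      ≡⟨ ⋆-congˡ g tail-θ n ⟩
         (tail (θ f) ⋆ g) n ∎) ⟩
  (θ f ⋆ g) (suc n) + (f ⋆ θ g) (suc n) ∎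
  where
  open ≡-Reasoning
  open +-*-Solver
  tail-θ : ∀ k → ι k * f (suc k) + f (suc k) ≡ ι (suc k) * f (suc k)
  tail-θ k = trans (solve 2 (λ i x → i :* x :+ x := (i :+ con 1ℚ) :* x) refl (ι k) (f (suc k)))
    (cong (_* f (suc k)) (sym (ι-suc k)))

exp : PowerSeries
exp = 1/_!

θ-exp : θ exp ≗ x·exp
θ-exp zero    = refl
θ-exp (suc n) = 1/suc! n

⋆x·exp : ∀ f → f ⋆ x·exp ≗ shift (f ⋆ exp)
⋆x·exp f zero    = trans (ℚ.+-identityʳ _) (ℚ.*-zeroʳ (f 0))
⋆x·exp f (suc n) = ⋆-tail f x·exp refl n

-- The Leibniz rule together with `θ-exp`: differentiating the factor exp multiplies the product by
-- x, that is, shifts it.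
θ-⋆-exp : ∀ f n → (θ f ⋆ exp) n ≡ ι n * (f ⋆ exp) n - shift (f ⋆ exp) n
θ-⋆-exp f n = begin
  (θ f ⋆ exp) n       ≡⟨ solve 2 (λ x y → x := (x :+ y) :- y) refl ((θ f ⋆ exp) n) ((f ⋆ θ exp) n) ⟩
  (θ f ⋆ exp) n + (f ⋆ θ exp) n - (f ⋆ θ exp) n
    ≡⟨ cong₂ _-_ (sym (θ-⋆ f exp n)) (trans (⋆-congʳ f θ-exp n) (⋆x·exp f n)) ⟩
  θ (f ⋆ exp) n - shift (f ⋆ exp) n ∎
  where
  open ≡-Reasoning
  open +-*-Solver

-- This is e^x = 1 + x · (e^x - 1)/x, where `tail exp-1` is the series (e^x - 1)/x.
⋆-exp-suc : ∀ f n → (f ⋆ exp) (suc n) ≡ (f ⋆ tail exp-1) n + f (suc n)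
⋆-exp-suc f zero    = solve 3 (λ a b c → a :* c :+ (b :* con 1ℚ :+ con 0ℚ) := (a :* c :+ con 0ℚ) :+ b) refl
      (f 0) (f 1) (exp 1)
  where open +-*-Solver
⋆-exp-suc f (suc n) = trans (cong (f 0 * exp (suc (suc n)) +_) (⋆-exp-suc (tail f) n))
  (sym (ℚ.+-assoc (f 0 * exp (suc (suc n))) _ _))

-- Powers of the series - log (1 - z)

δ : PowerSeries
δ zero    = 1ℚ
δ (suc _) = 0ℚ

-- logPower n d is the coefficient of zⁿ in Lⁿ⁻ᵈ for L = - log (1 - z), and 0 for
-- d > n; the recursion is (1 - z) (Lᵏ)′ = k Lᵏ⁻¹.
logPower : ℕ → PowerSeries
logPower zero    d = δ d
logPower (suc n) d = 1/suc n * (ι n * shift (logPower n) d + (ι (suc n) - ι d) * logPower n d)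

logPower-suc : ∀ n d → ι (suc n) * logPower (suc n) d ≡ ι n * shift (logPower n) d + (ι (suc n) - ι d) * logPower n d
logPower-suc n d = trans (sym (ℚ.*-assoc (ι (suc n)) (1/suc n) z)) (trans (cong (_* z) (ι*1/suc n)) (ℚ.*-identityˡ z))
  where z = ι n * shift (logPower n) d + (ι (suc n) - ι d) * logPower n d

-- A coefficient of positive degree in L^0 = 1.
logPower-diagonal : ∀ n → logPower (suc n) (suc n) ≡ 0ℚ
logPower-diagonal zero    = refl
logPower-diagonal (suc n) = ι-cancel (suc n) (begin
  m * logPower (suc (suc n)) (suc (suc n))  ≡⟨ logPower-suc (suc n) (suc (suc n)) ⟩
  ι (suc n) * logPower (suc n) (suc n) + (m - m) * logPower (suc n) (suc (suc n))
    ≡⟨ cong (λ z → ι (suc n) * z + (m - m) * logPower (suc n) (suc (suc n))) (logPower-diagonal n) ⟩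
  ι (suc n) * 0ℚ + (m - m) * logPower (suc n) (suc (suc n))
    ≡⟨ solve 3 (λ a m z → a :* con 0ℚ :+ (m :- m) :* z := m :* con 0ℚ) refl
          (ι (suc n)) m (logPower (suc n) (suc (suc n))) ⟩
  m * 0ℚ ∎)
  where
  open ≡-Reasoning
  open +-*-Solver
  m = ι (suc (suc n))

-- The coefficient of z^(n + 1) in L itself; this is where the value 1 / (r + 1) of the theorem
-- comes from.
logPower-subdiagonal : ∀ n → ι (suc n) * logPower (suc n) n ≡ 1ℚ
logPower-subdiagonal zero    = refl
logPower-subdiagonal (suc n) = begin
  ι (suc (suc n)) * logPower (suc (suc n)) (suc n)
    ≡⟨ logPower-suc (suc n) (suc n) ⟩
  ι (suc n) * logPower (suc n) n + c * logPower (suc n) (suc n)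
    ≡⟨ cong₂ (λ y z → y + c * z) (logPower-subdiagonal n) (logPower-diagonal n) ⟩
  1ℚ + c * 0ℚ
    ≡⟨ solve 1 (λ c → con 1ℚ :+ c :* con 0ℚ := con 1ℚ) refl c ⟩
  1ℚ ∎
  where
  open ≡-Reasoning
  open +-*-Solver
  c = ι (suc (suc n)) - ι (suc n)

-- Multiplication by exp in d amounts to multiplying Lⁿ⁻ᵈ by e^L = 1/(1 - z).
logPowerExp : ℕ → PowerSeries
logPowerExp n = logPower n ⋆ exp

-- The recursion of `logPower` multiplied by exp. The factor ι d acts as `θ`, and the shift produced
-- by `θ-⋆-exp` raises the coefficient ι n to ι (suc n).
logPowerExp-suc : ∀ n d → ι (suc n) * logPowerExp (suc n) d ≡ ι (suc n) * shift (logPowerExp n) d + (ι (suc n) - ι d) * logPowerExp n d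
logPowerExp-suc n d = begin
  N * logPowerExp (suc n) d
    ≡⟨ ⋆-scaleˡ N (logPower (suc n)) exp d ⟨
  ((λ k → N * logPower (suc n) k) ⋆ exp) d
    ≡⟨ ⋆-congˡ exp expand d ⟩
  ((λ k → (ι n * shift (logPower n) k + N * logPower n k) + - 1ℚ * θ (logPower n) k) ⋆ exp) d
    ≡⟨ ⋆-distribʳ (λ k → ι n * shift (logPower n) k + N * logPower n k) (λ k → - 1ℚ * θ (logPower n) k) exp d ⟩
  ((λ k → ι n * shift (logPower n) k + N * logPower n k) ⋆ exp) d + ((λ k → - 1ℚ * θ (logPower n) k) ⋆ exp) d
    ≡⟨ cong₂ _+_ (⋆-distribʳ (λ k → ι n * shift (logPower n) k) (λ k → N * logPower n k) exp d) (⋆-scaleˡ (- 1ℚ) (θ (logPower n)) exp d) ⟩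
  ((λ k → ι n * shift (logPower n) k) ⋆ exp) d + ((λ k → N * logPower n k) ⋆ exp) d + - 1ℚ * (θ (logPower n) ⋆ exp) d
    ≡⟨ cong₂ (λ y z → y + - 1ℚ * z)
         (cong₂ _+_ (trans (⋆-scaleˡ (ι n) (shift (logPower n)) exp d) (cong (ι n *_) (shift-⋆ (logPower n) exp d)))
                    (⋆-scaleˡ N (logPower n) exp d))
         (θ-⋆-exp (logPower n) d) ⟩
  ι n * shift (logPowerExp n) d + N * logPowerExp n d + - 1ℚ * (ι d * logPowerExp n d - shift (logPowerExp n) d)
    ≡⟨ solve 5 (λ i N e s v → i :* s :+ N :* v :+ con (- 1ℚ) :* (e :* v :- s) := (i :+ con 1ℚ) :* s :+ (N :- e) :* v) refl
         (ι n) N (ι d) (shift (logPowerExp n) d) (logPowerExp n d) ⟩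
  (ι n + 1ℚ) * shift (logPowerExp n) d + (N - ι d) * logPowerExp n d
    ≡⟨ cong (λ z → z * shift (logPowerExp n) d + (N - ι d) * logPowerExp n d) (ι-suc n) ⟨
  N * shift (logPowerExp n) d + (N - ι d) * logPowerExp n d ∎
  where
  open ≡-Reasoning
  open +-*-Solver
  N = ι (suc n)
  expand : ∀ k → N * logPower (suc n) k ≡ (ι n * shift (logPower n) k + N * logPower n k) + - 1ℚ * θ (logPower n) k
  expand k = trans (logPower-suc n k)
    (solve 5 (λ i N e s v → i :* s :+ (N :- e) :* v := (i :* s :+ N :* v) :+ con (- 1ℚ) :* (e :* v)) refl
      (ι n) N (ι k) (shift (logPower n) k) (logPower n k))

-- The coefficient of z^n in (L^k)′ = k L^(k - 1) / (1 - z) with k = n + 1 - d. The induction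
-- compares the recursions of the two sides.
logPowerExp-logPower : ∀ n d → d ≤ suc n → (ι (suc n) - ι d) * logPowerExp n d ≡ ι (suc n) * logPower (suc n) d
logPowerExp-logPower zero    zero          _ = refl
logPowerExp-logPower zero    (suc zero)    _ = refl
logPowerExp-logPower zero    (suc (suc d)) (s≤s ())
logPowerExp-logPower (suc n) d d≤ with ℕ.m≤n⇒m<n∨m≡n d≤
-- Here k = 0, and both sides vanish.
... | inj₂ refl = trans
  (solve 2 (λ m z → (m :- m) :* z := m :* con 0ℚ) refl (ι d) (logPowerExp (suc n) d))
  (cong (ι d *_) (sym (logPower-diagonal (suc n))))
  where open +-*-Solver
... | inj₁ d<   = ι-cancel n (begin
  N * ((M - ι d) * logPowerExp (suc n) d)
    ≡⟨ solve 3 (λ N x y → N :* (x :* y) := x :* (N :* y)) refl N (M - ι d) (logPowerExp (suc n) d) ⟩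
  (M - ι d) * (N * logPowerExp (suc n) d)
    ≡⟨ cong ((M - ι d) *_) (trans (logPowerExp-suc n d) (cong (N * shift (logPowerExp n) d +_) (logPowerExp-logPower n d (s≤s⁻¹ d<)))) ⟩
  (M - ι d) * (N * shift (logPowerExp n) d + N * logPower (suc n) d)
    ≡⟨ solve 4 (λ M N s z → M :* (N :* s :+ N :* z) := N :* (M :* s :+ M :* z)) refl
         (M - ι d) N (shift (logPowerExp n) d) (logPower (suc n) d) ⟩
  N * ((M - ι d) * shift (logPowerExp n) d + (M - ι d) * logPower (suc n) d)
    ≡⟨ cong (λ z → N * (z + (M - ι d) * logPower (suc n) d)) (shifted d d≤) ⟩
  N * (N * shift (logPower (suc n)) d + (M - ι d) * logPower (suc n) d)
    ≡⟨ cong (N *_) (logPower-suc (suc n) d) ⟨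
  N * (M * logPower (suc (suc n)) d) ∎)
  where
  open ≡-Reasoning
  open +-*-Solver
  N = ι (suc n)
  M = ι (suc (suc n))
  -- The induction hypothesis at d - 1: the factor n + 2 - d equals n + 1 - (d - 1).
  shifted : ∀ d → d ≤ suc (suc n) → (M - ι d) * shift (logPowerExp n) d ≡ N * shift (logPower (suc n)) d
  shifted zero    _         = trans (ℚ.*-zeroʳ (M - ι 0)) (sym (ℚ.*-zeroʳ N))
  shifted (suc d) (s≤s d≤n) = trans
    (cong (_* logPowerExp n d) (trans (cong₂ _-_ (ι-suc (suc n)) (ι-suc d))
      (solve 2 (λ x y → (x :+ con 1ℚ) :- (y :+ con 1ℚ) := x :- y) refl N (ι d))))
    (logPowerExp-logPower n d d≤n)

-- The identity e^L - 1 = z e^L, multiplied by L^(n - d) and read off at z^(n + 1).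
logPower-⋆-tail-exp-1 : ∀ n d → d ≤ n → (logPower (suc n) ⋆ tail exp-1) d ≡ logPowerExp n d
logPower-⋆-tail-exp-1 n d d≤n = ι-cancel n (begin
  N * (logPower (suc n) ⋆ tail exp-1) d
    ≡⟨ solve 3 (λ N x y → N :* x := N :* (x :+ y) :- N :* y) refl
          N ((logPower (suc n) ⋆ tail exp-1) d) (logPower (suc n) (suc d)) ⟩
  N * ((logPower (suc n) ⋆ tail exp-1) d + logPower (suc n) (suc d)) - N * logPower (suc n) (suc d)
    ≡⟨ cong (λ z → N * z - N * logPower (suc n) (suc d)) (⋆-exp-suc (logPower (suc n)) d) ⟨
  N * logPowerExp (suc n) (suc d) - N * logPower (suc n) (suc d)
    ≡⟨ cong (_- N * logPower (suc n) (suc d)) (trans (logPowerExp-suc n (suc d)) (cong (N * logPowerExp n d +_) (logPowerExp-logPower n (suc d) (s≤s d≤n)))) ⟩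
  N * logPowerExp n d + N * logPower (suc n) (suc d) - N * logPower (suc n) (suc d)
    ≡⟨ solve 2 (λ x y → (x :+ y) :- y := x) refl (N * logPowerExp n d) (N * logPower (suc n) (suc d)) ⟩
  N * logPowerExp n d ∎)
  where
  open ≡-Reasoning
  open +-*-Solver
  N = ι (suc n)

-- The identity L = z · b(L), which is 1 - z = e^(-L) solved for L.
logPower-⋆-b : ∀ n d → d ≤ n → (logPower n ⋆ b) d ≡ logPower (suc n) d
logPower-⋆-b n = ⋆-cancelʳ-≤ (tail exp-1) refl n (λ d d≤n → begin
  ((logPower n ⋆ b) ⋆ tail exp-1) d   ≡⟨ ⋆-assoc (logPower n) b (tail exp-1) d ⟩
  (logPower n ⋆ (b ⋆ tail exp-1)) d   ≡⟨ ⋆-congʳ (logPower n) b⋆ d ⟩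
  (logPower n ⋆ exp) d                ≡⟨ logPower-⋆-tail-exp-1 n d d≤n ⟨
  (logPower (suc n) ⋆ tail exp-1) d   ∎)
  where
  open ≡-Reasoning
  b⋆ : b ⋆ tail exp-1 ≗ exp
  b⋆ d = trans (⋆-congˡ (tail exp-1) egf-B d) (quotient-⋆ exp (tail exp-1) refl d)

-- The initial values

sumOver-concat-applyUpTo : ∀ {A : Set} (w : A → ℚ) F n →
  sumOver w (concat (applyUpTo F n)) ≡ sumℚ (applyUpTo (sumOver w ∘ F) n)
sumOver-concat-applyUpTo w F zero    = refl
sumOver-concat-applyUpTo w F (suc n) = trans (sumOver-++ w (F 0) _)
  (cong (sumOver w (F 0) +_) (sumOver-concat-applyUpTo w (F ∘ suc) n))

sumℚ-applyUpTo-cong : ∀ {f g : ℕ → ℚ} n → (∀ {k} → k < n → f k ≡ g k) →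
  sumℚ (applyUpTo f n) ≡ sumℚ (applyUpTo g n)
sumℚ-applyUpTo-cong zero    eq = refl
sumℚ-applyUpTo-cong (suc n) eq = cong₂ _+_ (eq (s≤s z≤n)) (sumℚ-applyUpTo-cong n (eq ∘ s≤s))

-- The suffix conditions of `S 1 r`, with the total d separated from the length r so that deleting
-- the first entry stays within the family.
record Ballot (r d : ℕ) (l : List ℕ) : Set where
  constructor ballot
  field
    length≡r : length l ≡ r
    sum≡d    : sum l ≡ d
    suffix  : ∀ j → sum (drop j l) ≤ r ∸ j

open Ballot

prepend : ∀ {r k x l} → x ℕ.+ k ≤ suc r → Ballot r k l → Ballot (suc r) (x ℕ.+ k) (x ∷ l)
prepend le p .length≡r = cong suc (length≡r p)
prepend {x = x} le p .sum≡d    = cong (x ℕ.+_) (sum≡d p)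
prepend {x = x} le p .suffix zero    = ℕ.≤-trans (ℕ.≤-reflexive (cong (x ℕ.+_) (sum≡d p))) le
prepend le p .suffix (suc j) = suffix p j

-- Grouped by the sum k of the entries after the first, which makes the weighted sum a coefficient
-- of a product of power series. For d > r the suffix bound at j = 0 leaves no sequence.
ballots : ∀ r d → Enumeration (Ballot r d)
ballots zero zero .list   = [] ∷ []
ballots zero zero .unique = [] ∷ []
ballots zero zero .sound (here refl) = ballot refl refl λ { zero → z≤n ; (suc j) → z≤n }
ballots zero zero .complete {[]} _ = here refl
ballots zero (suc d) .list   = []
ballots zero (suc d) .unique = []
ballots zero (suc d) .sound ()
ballots zero (suc d) .complete {[]} p = contradiction (sum≡d p) λ ()
ballots (suc r) d with d ℕ.≤? suc r
... | no d≰ = record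
  { list = [] ; unique = [] ; sound = λ ()
  ; complete = λ p → contradiction (subst (_≤ suc r) (sum≡d p) (suffix p 0)) d≰ }
... | yes d≤ = record
  { list     = concat (applyUpTo F (suc d))
  ; unique   = Unique.concat⁺
      (All.applyUpTo⁺₂ F (suc d) (λ k → Unique.map⁺ List.∷-injectiveʳ (unique (ballots r k))))
      (AllPairs.applyUpTo⁺₁ F (suc d) disjoint)
  ; sound    = sound′
  ; complete = complete′
  }
  where
  F : ℕ → List (List ℕ)
  F k = map ((d ∸ k) ∷_) (list (ballots r k))
  sum-tail : ∀ {k l} → l ∈ F k → sum (drop 1 l) ≡ k
  sum-tail {k} l∈ with ∈-map⁻ ((d ∸ k) ∷_) l∈
  ... | l , l∈′ , refl = sum≡d (sound (ballots r k) l∈′)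
  disjoint : ∀ {i j} → i < j → j < suc d → ∀ {l} → ¬ (l ∈ F i × l ∈ F j)
  disjoint i<j _ (p , q) = ℕ.<⇒≢ i<j (trans (sym (sum-tail p)) (sum-tail q))
  sound′ : ∀ {l} → l ∈ concat (applyUpTo F (suc d)) → Ballot (suc r) d l
  sound′ l∈ with ∈-concat⁻′ (applyUpTo F (suc d)) l∈
  ... | _ , l∈F , F∈ with ∈-applyUpTo⁻ F F∈
  ... | k , s≤s k≤d , refl with ∈-map⁻ ((d ∸ k) ∷_) l∈F
  ... | l , l∈′ , refl = subst (λ z → Ballot (suc r) z ((d ∸ k) ∷ l)) eq
    (prepend (subst (_≤ suc r) (sym eq) d≤) (sound (ballots r k) l∈′))
    where
    eq : d ∸ k ℕ.+ k ≡ d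
    eq = ℕ.m∸n+n≡m k≤d
  complete′ : ∀ {l} → Ballot (suc r) d l → l ∈ concat (applyUpTo F (suc d))
  complete′ {[]} p = contradiction (length≡r p) λ ()
  complete′ {x ∷ l} p with sum≡d p
  ... | refl = ∈-concat⁺′ l∈F (∈-applyUpTo⁺ F (s≤s (ℕ.m≤n+m (sum l) x)))
    where
    l∈F : x ∷ l ∈ F (sum l)
    l∈F = subst (λ z → x ∷ l ∈ map (z ∷_) (list (ballots r (sum l)))) (sym (ℕ.m+n∸n≡m x (sum l)))
      (∈-map⁺ (x ∷_) (complete (ballots r (sum l))
        (ballot (ℕ.suc-injective (length≡r p)) refl (λ j → suffix p (suc j)))))

-- Prepending an entry is a convolution with `b`, and by `logPower-⋆-b` this raises the index of
-- `logPower` by one. The range includes d = r + 1 because the convolution for the next length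
-- reaches it.
∑-ballots : ∀ r d → d ≤ suc r → ∑ᴱ (weight b) (ballots r d) ≡ logPower (suc r) d
∑-ballots zero    zero          _ = refl
∑-ballots zero    (suc zero)    _ = refl
∑-ballots zero    (suc (suc d)) (s≤s ())
∑-ballots (suc r) d d≤ with d ℕ.≤? suc r
-- This is d = r + 2: no sequence qualifies, and z^(r + 2) has coefficient 0 in L^0.
... | no d≰ = begin
  0ℚ                              ≡⟨ logPower-diagonal (suc r) ⟨
  logPower (suc (suc r)) (suc (suc r))   ≡⟨ cong (logPower (suc (suc r))) (ℕ.≤-antisym d≤ (ℕ.≰⇒> d≰)) ⟨
  logPower (suc (suc r)) d               ∎
  where open ≡-Reasoning
... | yes d≤r = begin
  sumOver (weight b) (concat (applyUpTo F (suc d)))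
    ≡⟨ sumOver-concat-applyUpTo (weight b) F (suc d) ⟩
  sumℚ (applyUpTo (sumOver (weight b) ∘ F) (suc d))
    ≡⟨ sumℚ-applyUpTo-cong (suc d) term ⟩
  (logPower (suc r) ⋆ b) d
    ≡⟨ logPower-⋆-b (suc r) d d≤r ⟩
  logPower (suc (suc r)) d ∎
  where
  open ≡-Reasoning
  F : ℕ → List (List ℕ)
  F k = map ((d ∸ k) ∷_) (list (ballots r k))
  term : ∀ {k} → k < suc d → sumOver (weight b) (F k) ≡ logPower (suc r) k * b (d ∸ k)
  term {k} (s≤s k≤d) = begin
    sumOver (weight b) (F k)
      ≡⟨ sumOver-map (weight b) ((d ∸ k) ∷_) (list (ballots r k)) ⟩
    sumOver (λ l → b (d ∸ k) * weight b l) (list (ballots r k))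
      ≡⟨ sumOver-*ˡ (b (d ∸ k)) (weight b) (list (ballots r k)) ⟩
    b (d ∸ k) * ∑ᴱ (weight b) (ballots r k)
      ≡⟨ cong (b (d ∸ k) *_) (∑-ballots r k (ℕ.≤-trans k≤d d≤r)) ⟩
    b (d ∸ k) * logPower (suc r) k
      ≡⟨ ℚ.*-comm (b (d ∸ k)) (logPower (suc r) k) ⟩
    logPower (suc r) k * b (d ∸ k) ∎

-- The suffix bounds outside 1 ≤ j < r come for free: at j = 0 from the total, and for j ≥ r because
-- the suffix is empty.
InS⇒Ballot : ∀ {r} n → InS 1 r n → Ballot r r (toList n)
InS⇒Ballot n (s , _ , a) .length≡r = Vec.length-toList n
InS⇒Ballot n (s , _ , a) .sum≡d    = s
InS⇒Ballot n (s , _ , a) .suffix zero = ℕ.≤-reflexive s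
InS⇒Ballot {r} n (s , _ , a) .suffix (suc j) with suc j ℕ.<? r
... | yes j<r = a (suc j) (s≤s z≤n) j<r
... | no  j≮r = ℕ.≤-trans (ℕ.≤-reflexive (cong sum
  (List.drop-all (suc j) (toList n) (ℕ.≤-trans (ℕ.≤-reflexive (Vec.length-toList n)) (ℕ.≮⇒≥ j≮r))))) z≤n

Ballot⇒InS : ∀ {r} n → Ballot r r (toList n) → InS 1 r n
Ballot⇒InS n p = sum≡d p , (λ _ 1≤j j<1 → contradiction j<1 (ℕ.≤⇒≯ 1≤j)) , λ j _ _ → suffix p j

initial : ∀ r → C[ 1 , r ] ≡ (-1ℤ ℤ.^ r) / suc r
initial r = begin
  C[ 1 , r ]                                       ≡⟨ C-toList (S 1 r) ⟩
  [-1]^ r * ∑ᴱ (weight b) E                        ≡⟨ cong ([-1]^ r *_) (∑ᴱ-⇔ E (ballots r r) id id) ⟩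
  [-1]^ r * ∑ᴱ (weight b) (ballots r r)            ≡⟨ cong ([-1]^ r *_) (∑-ballots r r (ℕ.n≤1+n r)) ⟩
  [-1]^ r * logPower (suc r) r
    ≡⟨ cong ([-1]^ r *_) (ι-cancel r (trans (logPower-subdiagonal r) (sym (ι*1/suc r)))) ⟩
  [-1]^ r * 1/suc r                                ≡⟨ /-* (-1ℤ ℤ.^ r) 1ℤ 1 (suc r) ⟩
  ((-1ℤ ℤ.^ r) ℤ.* 1ℤ) / (1 ℕ.* suc r)
    ≡⟨ ℚ./-cong (ℤ.*-identityʳ (-1ℤ ℤ.^ r)) (ℕ.*-identityˡ (suc r)) ⟩
  (-1ℤ ℤ.^ r) / suc r                              ∎
  where
  open ≡-Reasoning
  E : Enumeration (Ballot r r)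
  -- Its list is by definition that of `S 1 r`, so the sum in `C[ 1 , r ]` is already a sum over
  -- `E`.
  E = S-enumeration {1} {r} length≡r InS⇒Ballot Ballot⇒InS

theorem3p2 : (∀ (i r : ℕ) → 1 ≤ i → i < r →
    C[ i ℕ.+ 1 , r ]
    ≡ C[ i , r ]
    + ∑[ r ∸ i ℕ.+ 1 ⋯ r ∸ 1 ] (λ k → C[ r ∸ i ℕ.+ 1 , k ] * C[ r ∸ k , r ∸ k ])
    - ∑[ i ⋯ r ∸ 1 ] (λ k → C[ i , k ] * C[ r ∸ k , r ∸ k ]))
    × (∀ (r : ℕ) → 1 ≤ r → C[ 1 , r ] ≡ (-1ℤ ℤ.^ r) / suc r)
theorem3p2 = recurrence , λ r _ → initial r
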